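{- Let $p$ be a prime number, $G$ a transitive group of degree $n\in p\mathbb{Z}\setminus p^{2}\mathbb{Z}$, and $H$ a corresponding subgroup of $G$. Assume that a $p$-Sylow subgroup $S_{p}$ of $G$ is normal and that $S_{p}\cong (C_{p})^{m}$ for some $m\neq 2$. Then $\operatorname{Sha}_{\mathcal{D}}^{2}(G,J_{G/H})[p^{\infty}]=0$ for every admissible set $\mathcal{D}$ of subgroups of $G$.
   Context: A transitive group of degree $n$ is a subgroup of $\mathfrak{S}_n$ acting transitively on $\{1,\dots,n\}$; a corresponding subgroup is a point stabilizer. $J_{G/H}$ is the cokernel of $\mathbb{Z}\to\operatorname{Ind}_H^G\mathbb{Z}=\mathrm{Hom}_{\mathbb{Z}[H]}(\mathbb{Z}[G],\mathbb{Z})$, $1\mapsto$ constant function $1$. $\operatorname{Sha}^2_{\mathcal{D}}(G,M):=\ker\big(H^2(G,M)\to\bigoplus_{D\in\mathcal{D}}H^2(D,M)\big)$. A finite set of subgroups is admissible if it contains all cyclic subgroups and is stable under conjugation. $A[p^\infty]$ is the $p$-primary torsion part. -}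

module Defs where

open import Level using (0ℓ)
open import Data.Nat as ℕ using (ℕ; zero; suc; NonZero)
open import Data.Nat.Divisibility using (_∣_)
open import Data.Nat.DivMod using (_mod_)
open import Data.Nat.Primality using (Prime; prime⇒nonZero)
open import Data.Integer as ℤ using (ℤ)
open import Data.Fin using (Fin; toℕ)
open import Data.Vec using (Vec; lookup; tabulate; zipWith)
open import Data.List using (List; length)
open import Data.List.Membership.Propositional using (_∈_)
open import Data.List.Relation.Unary.Any using (Any)
open import Data.List.Relation.Unary.Unique.Propositional using (Unique)
open import Data.Product using (Σ; ∃; ∃-syntax; _×_; _,_)
open import Relation.Binary.PropositionalEquality using (_≡_)
open import Relation.Nullary using (¬_)
open import Function using (id; _⇔_)

-- Permutations of {0,…,n-1}: σ is stored as the vector (σ 0, …, σ (n-1)).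

Perm : ℕ → Set
Perm n = Vec (Fin n) n

-- σ is a bijection (injective self-map of a finite set)
IsPerm : ∀ {n} → Perm n → Set
IsPerm σ = ∀ i j → lookup σ i ≡ lookup σ j → i ≡ j

_·ₚ_ : ∀ {n} → Perm n → Fin n → Fin n
σ ·ₚ i = lookup σ i

_*_ : ∀ {n} → Perm n → Perm n → Perm n
σ * τ = tabulate (λ i → lookup σ (lookup τ i))

idP : ∀ {n} → Perm n
idP = tabulate id

_^ₚ_ : ∀ {n} → Perm n → ℕ → Perm n
g ^ₚ zero  = idP
g ^ₚ suc k = g * (g ^ₚ k)

record Subgroup (n : ℕ) : Set where
  field
    elems     : List (Perm n)
    unique    : Unique elems
    perms     : ∀ {x} → x ∈ elems → IsPerm x
    has-id    : idP ∈ elems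
    mul-closed : ∀ {x y} → x ∈ elems → y ∈ elems → (x * y) ∈ elems
    inv-closed : ∀ {x} → x ∈ elems → ∃[ y ] (y ∈ elems × x * y ≡ idP)
open Subgroup public

_∈ˢ_ : ∀ {n} → Perm n → Subgroup n → Set
x ∈ˢ K = x ∈ elems K

order : ∀ {n} → Subgroup n → ℕ
order K = length (elems K)

_≤ˢ_ : ∀ {n} → Subgroup n → Subgroup n → Set
K ≤ˢ L = ∀ {x} → x ∈ˢ K → x ∈ˢ L

IsTransitive : ∀ {n} → Subgroup n → Set
IsTransitive {n} G = ∀ (i j : Fin n) → ∃[ g ] (g ∈ˢ G × g ·ₚ i ≡ j)

IsPointStabilizer : ∀ {n} → Subgroup n → Subgroup n → Fin n → Set
IsPointStabilizer G H i₀ = ∀ x → (x ∈ˢ H) ⇔ (x ∈ˢ G × x ·ₚ i₀ ≡ i₀)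

IsSylow : ∀ {n} → ℕ → Subgroup n → Subgroup n → Set
IsSylow p G S = S ≤ˢ G × ∃[ v ] ∃[ r ]
  (order S ≡ p ℕ.^ v × order G ≡ order S ℕ.* r × ¬ (p ∣ r))

IsNormal : ∀ {n} → Subgroup n → Subgroup n → Set
IsNormal G S = ∀ {g s} → g ∈ˢ G → s ∈ˢ S → ∃[ s' ] (s' ∈ˢ S × g * s ≡ s' * g)

module _ (p : ℕ) .{{_ : NonZero p}} where
  _+ᶜ_ : ∀ {m} → Vec (Fin p) m → Vec (Fin p) m → Vec (Fin p) m
  u +ᶜ v = zipWith (λ a b → (toℕ a ℕ.+ toℕ b) mod p) u v

IsoToCpPower : ∀ {n} (p : ℕ) → Prime p → ℕ → Subgroup n → Set
IsoToCpPower {n} p pr m S =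
  let instance _ = prime⇒nonZero pr in
  Σ (Vec (Fin p) m → Perm n) λ ι →
      (∀ u → ι u ∈ˢ S)
    × (∀ {s} → s ∈ˢ S → ∃[ u ] (ι u ≡ s))
    × (∀ u v → ι u ≡ ι v → u ≡ v)
    × (∀ u v → ι (_+ᶜ_ p u v) ≡ ι u * ι v)

SameElems : ∀ {n} → Subgroup n → Subgroup n → Set
SameElems K L = ∀ x → (x ∈ˢ K) ⇔ (x ∈ˢ L)

IsCyclicGenBy : ∀ {n} → Subgroup n → Perm n → Set
IsCyclicGenBy D g = ∀ x → (x ∈ˢ D) ⇔ (∃[ k ] (x ≡ g ^ₚ k))

IsConjugateBy : ∀ {n} → Perm n → Subgroup n → Subgroup n → Set
IsConjugateBy g K L = ∀ x → (x ∈ˢ L) ⇔ (∃[ k ] (k ∈ˢ K × x * g ≡ g * k))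

IsAdmissible : ∀ {n} → Subgroup n → List (Subgroup n) → Set
IsAdmissible G 𝒟 =
    (∀ {D} → D ∈ 𝒟 → D ≤ˢ G)
  × (∀ {g} → g ∈ˢ G → Any (λ D → IsCyclicGenBy D g) 𝒟)
  × (∀ {g D} → g ∈ˢ G → D ∈ 𝒟 → Any (IsConjugateBy g D) 𝒟)

-- The modules Ind_H^G ℤ and J_{G/H}, and H² with these coefficients.
--
-- Ind_H^G ℤ = Hom_{ℤ[H]}(ℤ[G], ℤ) is represented by functions
-- x : Perm n → ℤ (only values on G matter) with x(h y) = x(y) for h ∈ H,
-- with G acting by (g·x)(y) = x(y g).
-- J_{G/H} = Ind_H^G ℤ / ℤ·1 : representatives are elements of Ind, and
-- two are equal in J iff their difference is a constant function on G.

Cochain : ℕ → Set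
Cochain n = Perm n → ℤ

IsInd : ∀ {n} → Subgroup n → Subgroup n → Cochain n → Set
IsInd G H x = ∀ {h y} → h ∈ˢ H → y ∈ˢ G → x (h * y) ≡ x y

_≈J[_]_ : ∀ {n} → Cochain n → Subgroup n → Cochain n → Set
x ≈J[ G ] y = ∃[ c ] (∀ {z} → z ∈ˢ G → x z ≡ y z ℤ.+ c)

act : ∀ {n} → Perm n → Cochain n → Cochain n
act g x y = x (y * g)

_⊕_ : ∀ {n} → Cochain n → Cochain n → Cochain n
(x ⊕ y) z = x z ℤ.+ y z

_⊖_ : ∀ {n} → Cochain n → Cochain n → Cochain n
(x ⊖ y) z = x z ℤ.- y z

zeroJ : ∀ {n} → Cochain n
zeroJ _ = ℤ.0ℤ

Cochain2 : ℕ → Set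
Cochain2 n = Perm n → Perm n → Cochain n

Is2Cocycle : ∀ {n} → Subgroup n → Subgroup n → Cochain2 n → Set
Is2Cocycle G H f =
    (∀ {a b} → a ∈ˢ G → b ∈ˢ G → IsInd G H (f a b))
  × (∀ {a b c} → a ∈ˢ G → b ∈ˢ G → c ∈ˢ G →
       (((act a (f b c) ⊖ f (a * b) c) ⊕ f a (b * c)) ⊖ f a b) ≈J[ G ] zeroJ)

IsCoboundaryOn : ∀ {n} → Subgroup n → Subgroup n → Subgroup n → Cochain2 n → Set
IsCoboundaryOn {n} G H K f =
  Σ (Perm n → Cochain n) λ φ →
      (∀ {a} → a ∈ˢ K → IsInd G H (φ a))
    × (∀ {a b} → a ∈ˢ K → b ∈ˢ K →
         f a b ≈J[ G ] ((act a (φ b) ⊖ φ (a * b)) ⊕ φ a))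

scale2 : ∀ {n} → ℕ → Cochain2 n → Cochain2 n
scale2 k f a b z = ℤ.+ k ℤ.* f a b z

{-# OPTIONS --safe #-}

-- Evaluating cochains at the points of Fin n turns J into ℤⁿ modulo constants. By transfer,
-- restriction to S is injective on p-power torsion, so it suffices to trivialize f on S. If m ≤ 1,
-- then S is cyclic and this is part of the hypothesis.
--
-- Let m ≥ 3. A nonzero multiple N f is bounded by some V on S, by transfer from the trivial group.
-- Then V is a crossed homomorphism modulo N and constants, and f is trivial on S once V is
-- principal (Bockstein). Since p² ∤ n and S is normal, S-orbits have at most p points, so the
-- powers of an element moving i are transitive on the S-orbit of i. The constants in V define a
-- central extension of S, which splits canonically over each point stabilizer Sᵢ; triviality of f
-- on cyclic subgroups makes these splittings agree on Sᵢ ∩ Sⱼ. Three stabilizers in general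
-- position glue to a splitting over S which extends all the others, and by Shapiro's lemma V is
-- principal.

module Submission where

open import Defs
open import Level using (0ℓ)
open import Algebra.Bundles using (Monoid)
import Algebra.Properties.Monoid as MonoidProperties
open import Data.Nat as ℕ using (ℕ; zero; suc; _^_)
import Data.Nat.Properties as ℕₚ
open import Data.Nat.Coprimality using (Coprime; coprime-Bézout; coprime-divisor; prime⇒coprime)
open import Data.Nat.Divisibility using
  (_∣_; _∣?_; divides; ∣-refl; ∣-trans; ∣1⇒≡1; m∣m*n; *-monoˡ-∣)
open import Data.Nat.DivMod using (_mod_; _%_; m<n⇒m%n≡m; m%n<n; %-distribˡ-+; m*n%n≡0)
open import Data.Nat.GCD using (module Bézout)
open import Data.Nat.Primality using (Prime; prime⇒nonZero; prime⇒nonTrivial; prime⇒irreducible)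
open import Data.Integer as ℤ using (ℤ; 0ℤ; -_; _+_; _-_) renaming (_*_ to _·_)
import Data.Integer.Properties as ℤₚ
open import Data.Integer.Divisibility.Signed as ℤᵈ using
  (∣m∣n⇒∣m+n; ∣n⇒∣m*n; 0∣⇒≡0) renaming (_∣_ to _∣ᶻ_)
open import Data.Integer.Tactic.RingSolver using (solve-∀)
open import Data.Fin using (Fin; toℕ) renaming (zero to fzero; suc to fsuc)
import Data.Fin.Properties as Finₚ
open import Data.Vec as Vec using (Vec; []; _∷_; lookup; replicate; zipWith)
open import Data.Vec.Properties as Vecₚ using
  ( lookup∘tabulate; tabulate∘lookup; tabulate-cong; ≡-dec; lookup-zipWith; lookup-map
  ; lookup-replicate; map-const; zipWith-comm; zipWith-replicate )
open import Data.List using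
  ( List; []; _∷_; _++_; length; map; foldr; filter; allFin; upTo; cartesianProduct; deduplicate )
open import Data.List.Properties using
  (length-map; length-++; length-tabulate; length-upTo; ++-identityʳ; map-∘)
open import Data.List.Membership.Propositional using (_∈_; find; lose)
open import Data.List.Membership.Propositional.Properties
open import Data.List.Relation.Binary.Permutation.Propositional using
  (_↭_; prep; ↭-refl; ↭-sym; ↭-trans; ↭⇒↭ₛ)
open import Data.List.Relation.Binary.Permutation.Propositional.Properties using
  (↭-length; ∈-resp-↭; shift; map⁺)
import Data.List.Relation.Binary.Permutation.Setoid.Properties as Permutationₛ
open import Data.List.Relation.Binary.Subset.Propositional using (_⊆_)
open import Data.List.Relation.Unary.All as All using ([]; _∷_)
import Data.List.Relation.Unary.All.Properties as Allₚ
open import Data.List.Relation.Unary.AllPairs as AllPairs using (AllPairs; []; _∷_)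
open import Data.List.Relation.Unary.Any as Any using (here; there)
import Data.List.Relation.Unary.Any.Properties as Anyₚ
open import Data.List.Relation.Unary.Unique.Propositional using (Unique)
import Data.List.Relation.Unary.Unique.Propositional.Properties as Uniqueₚ
import Data.List.Relation.Unary.Unique.DecSetoid.Properties as DecUniqueₚ
open import Data.Product using (∃-syntax; Σ-syntax; _×_; _,_; proj₁; proj₂; uncurry)
open import Data.Sum using (inj₁; inj₂)
open import Function using (_∘_; id; Equivalence)
open import Relation.Binary.Bundles using (Setoid; DecSetoid)
open import Relation.Binary.Definitions using (DecidableEquality; tri<; tri≈; tri>)
open import Relation.Binary.PropositionalEquality
import Relation.Binary.Reasoning.Setoid as SetoidReasoning
open import Relation.Nullary using (¬_; Dec; yes; no; contradiction)
open import Relation.Nullary.Decidable using (¬?; decidable-stable; map′)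

-- Arithmetic

∤⇒coprime : ∀ {p d} → Prime p → ¬ (p ∣ d) → Coprime d p
∤⇒coprime pr p∤d (e∣d , e∣p) with prime⇒irreducible pr e∣p
... | inj₁ e≡1  = e≡1
... | inj₂ refl = contradiction e∣d p∤d

coprime-^ : ∀ {d p} → Coprime d p → ∀ v → Coprime d (p ^ v)
coprime-^ d⊥p zero    (_   , e∣1)    = ∣1⇒≡1 e∣1
coprime-^ d⊥p (suc v) (e∣d , e∣p*pᵛ) = coprime-^ d⊥p v (e∣d , coprime-divisor e⊥p e∣p*pᵛ)
  where
  e⊥p : Coprime _ _
  e⊥p (f∣e , f∣p) = d⊥p (∣-trans f∣e e∣d , f∣p)

∣p^v∧p²∤⇒≤p : ∀ {p d} → Prime p → ∀ v → d ∣ p ^ v → ¬ (p ^ 2 ∣ d) → d ℕ.≤ p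
∣p^v∧p²∤⇒≤p {p} {d} pr v d∣pᵛ p²∤d with p ∣? d
... | no  p∤d rewrite coprime-^ (∤⇒coprime pr p∤d) v (∣-refl , d∣pᵛ) =
  ℕ.>-nonZero⁻¹ p {{prime⇒nonZero pr}}
... | yes (divides q refl) = ℕₚ.≤-reflexive (trans (cong (ℕ._* p) q≡1) (ℕₚ.*-identityˡ p))
  where
  p∤q : ¬ (p ∣ q)
  p∤q p∣q = p²∤d (subst (_∣ q ℕ.* p) (cong (p ℕ.*_) (sym (ℕₚ.*-identityʳ p))) (*-monoˡ-∣ p p∣q))
  q≡1 : q ≡ 1
  q≡1 = coprime-^ (∤⇒coprime pr p∤q) v (∣-refl , ∣-trans (m∣m*n p) d∣pᵛ)

consecutive-multiples⇒bézout : ∀ {k l x y} → 1 ℕ.+ y ℕ.* l ≡ x ℕ.* k →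
  ℤ.+ x · ℤ.+ k - ℤ.+ y · ℤ.+ l ≡ ℤ.1ℤ
consecutive-multiples⇒bézout {k} {l} {x} {y} 1+yl≡xk = begin
  ℤ.+ x · ℤ.+ k - yl           ≡⟨ cong (_- yl) (ℤₚ.pos-* x k) ⟨
  ℤ.+ (x ℕ.* k) - yl           ≡⟨ cong (λ m → ℤ.+ m - yl) 1+yl≡xk ⟨
  ℤ.1ℤ + ℤ.+ (y ℕ.* l) - yl    ≡⟨ cong (λ m → ℤ.1ℤ + m - yl) (ℤₚ.pos-* y l) ⟩
  ℤ.1ℤ + yl - yl               ≡⟨ cancel yl ⟩
  ℤ.1ℤ                         ∎
  where
  open ≡-Reasoning
  yl : ℤ
  yl = ℤ.+ y · ℤ.+ l
  cancel : ∀ x → ℤ.1ℤ + x - x ≡ ℤ.1ℤ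
  cancel = solve-∀

coprime⇒bézout : ∀ {k l} → Coprime k l → ∃[ x ] ∃[ y ] (x · ℤ.+ k + y · ℤ.+ l ≡ ℤ.1ℤ)
coprime⇒bézout {k} {l} k⊥l with coprime-Bézout k⊥l
... | Bézout.+- x y 1+yl≡xk = ℤ.+ x , - (ℤ.+ y) , trans
  (regroup (ℤ.+ x) (ℤ.+ k) (ℤ.+ y) (ℤ.+ l)) (consecutive-multiples⇒bézout {x = x} {y} 1+yl≡xk)
  where
  regroup : ∀ x k y l → x · k + - y · l ≡ x · k - y · l
  regroup = solve-∀
... | Bézout.-+ x y 1+xk≡yl = - (ℤ.+ x) , ℤ.+ y , trans
  (regroup (ℤ.+ x) (ℤ.+ k) (ℤ.+ y) (ℤ.+ l)) (consecutive-multiples⇒bézout {x = y} {x} 1+xk≡yl)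
  where
  regroup : ∀ x k y l → - x · k + y · l ≡ y · l - x · k
  regroup = solve-∀

-- Lists without repetition

-- abstract, since conversion checking would otherwise unfold the membership test.
abstract
  choice : {A B : Set} → DecidableEquality A → B → {P : A → B → Set} {xs : List A} →
    (∀ {x} → x ∈ xs → ∃[ y ] P x y) → Σ[ f ∈ (A → B) ] (∀ {x} → x ∈ xs → P x (f x))
  choice {A} {B} _≟_ default {P} {xs} exists = f , f-spec
    where
    f : A → B
    f x with Any.any? (x ≟_) xs
    ... | yes x∈ = proj₁ (exists x∈)
    ... | no  _  = default
    f-spec : ∀ {x} → x ∈ xs → P x (f x)
    f-spec {x} x∈ with Any.any? (x ≟_) xs
    ... | yes x∈′ = proj₂ (exists x∈′)
    ... | no  x∉  = contradiction x∈ x∉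

module _ {A : Set} where

  unique∧⊆⇒++↭ : {xs ys : List A} → Unique xs → xs ⊆ ys → ∃[ zs ] (ys ↭ xs ++ zs)
  unique∧⊆⇒++↭ {ys = ys} [] _ = ys , ↭-refl
  unique∧⊆⇒++↭ {x ∷ xs} (x∉xs ∷ uxs) xs⊆ys
    with as , bs , refl ← ∈-∃++ (xs⊆ys (here refl)) =
    let (zs , p) = unique∧⊆⇒++↭ uxs xs⊆as++bs in zs , ↭-trans (shift x as bs) (prep x p)
    where
    xs⊆as++bs : xs ⊆ as ++ bs
    xs⊆as++bs y∈xs with ∈-resp-↭ (shift x as bs) (xs⊆ys (there y∈xs))
    ... | here y≡x = contradiction (sym y≡x) (All.lookup x∉xs y∈xs)
    ... | there y∈ = y∈

  unique∧⊆⇒length≤ : {xs ys : List A} → Unique xs → xs ⊆ ys → length xs ℕ.≤ length ys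
  unique∧⊆⇒length≤ {xs} uxs xs⊆ys with zs , p ← unique∧⊆⇒++↭ uxs xs⊆ys =
    subst (length xs ℕ.≤_) (sym (trans (↭-length p) (length-++ xs)))
      (ℕₚ.m≤m+n (length xs) (length zs))

  map-unique : {B : Set} {f : A → B} {xs : List A} →
    (∀ {x y} → x ∈ xs → y ∈ xs → f x ≡ f y → x ≡ y) → Unique xs → Unique (map f xs)
  map-unique f-inj []           = []
  map-unique f-inj (x∉xs ∷ uxs) =
    Allₚ.map⁺ (All.tabulate λ y∈ fx≡fy → All.lookup x∉xs y∈ (f-inj (here refl) (there y∈) fx≡fy))
    ∷ map-unique (λ x∈ y∈ → f-inj (there x∈) (there y∈)) uxs

  unique∧⊆∧length≤⇒↭ : {xs ys : List A} → Unique xs → xs ⊆ ys → length ys ℕ.≤ length xs → ys ↭ xs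
  unique∧⊆∧length≤⇒↭ {xs} uxs xs⊆ys ys≤xs with unique∧⊆⇒++↭ uxs xs⊆ys
  ... | []     , p = subst (_ ↭_) (++-identityʳ xs) p
  ... | z ∷ zs , p = contradiction
    (subst (ℕ._≤ length xs) (trans (↭-length p) (length-++ xs)) ys≤xs) (ℕₚ.m+1+n≰m (length xs))

  injective-endo-↭ : {f : A → A} {xs : List A} → Unique xs →
    (∀ {x} → x ∈ xs → f x ∈ xs) →
    (∀ {x y} → x ∈ xs → y ∈ xs → f x ≡ f y → x ≡ y) →
    map f xs ↭ xs
  injective-endo-↭ {f} {xs} uxs f∈ f-inj =
    ↭-sym (unique∧⊆∧length≤⇒↭ (map-unique f-inj uxs) map⊆ (ℕₚ.≤-reflexive (sym (length-map f xs))))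
    where
    map⊆ : map f xs ⊆ xs
    map⊆ y∈ with x , x∈ , refl ← ∈-map⁻ f y∈ = f∈ x∈

length-cartesianProduct : {A B : Set} (xs : List A) (ys : List B) →
  length (cartesianProduct xs ys) ≡ length xs ℕ.* length ys
length-cartesianProduct []       ys = refl
length-cartesianProduct (x ∷ xs) ys = trans (length-++ (map (x ,_) ys))
  (cong₂ ℕ._+_ (length-map (x ,_) ys) (length-cartesianProduct xs ys))

length-*-bijection : {A B C : Set} {xs : List A} {ys : List B} {zs : List C} (f : A → B → C) →
  Unique xs → Unique ys → Unique zs →
  (∀ {x y} → x ∈ xs → y ∈ ys → f x y ∈ zs) →
  (∀ {z} → z ∈ zs → ∃[ x ] ∃[ y ] (x ∈ xs × y ∈ ys × z ≡ f x y)) →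
  (∀ {x y x′ y′} → x ∈ xs → y ∈ ys → x′ ∈ xs → y′ ∈ ys → f x y ≡ f x′ y′ → x ≡ x′ × y ≡ y′) →
  length xs ℕ.* length ys ≡ length zs
length-*-bijection {xs = xs} {ys} {zs} f uxs uys uzs f∈ f-onto f-inj = begin
  length xs ℕ.* length ys  ≡⟨ length-cartesianProduct xs ys ⟨
  length pairs             ≡⟨ length-map (uncurry f) pairs ⟨
  length products          ≡⟨ ℕₚ.≤-antisym (unique∧⊆⇒length≤ products-unique products⊆zs)
                                           (unique∧⊆⇒length≤ uzs zs⊆products) ⟩
  length zs                ∎
  where
  open ≡-Reasoning
  pairs : List _
  pairs = cartesianProduct xs ys
  products : List _
  products = map (uncurry f) pairs
  products-unique : Unique products
  products-unique = map-unique injective (Uniqueₚ.cartesianProduct⁺ uxs uys)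
    where
    injective : ∀ {u v} → u ∈ pairs → v ∈ pairs → uncurry f u ≡ uncurry f v → u ≡ v
    injective u∈ v∈ eq =
      let (x∈ , y∈)   = ∈-cartesianProduct⁻ xs ys u∈
          (x′∈ , y′∈) = ∈-cartesianProduct⁻ xs ys v∈
      in uncurry (cong₂ _,_) (f-inj x∈ y∈ x′∈ y′∈ eq)
  products⊆zs : products ⊆ zs
  products⊆zs z∈ with (x , y) , u∈ , refl ← ∈-map⁻ (uncurry f) z∈ =
    uncurry f∈ (∈-cartesianProduct⁻ xs ys u∈)
  zs⊆products : zs ⊆ products
  zs⊆products z∈ with x , y , x∈ , y∈ , refl ← f-onto z∈ =
    ∈-map⁺ (uncurry f) (∈-cartesianProduct⁺ x∈ y∈)

module Transversal (D : DecSetoid 0ℓ 0ℓ) (xs : List (DecSetoid.Carrier D)) where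

  open DecSetoid D using (_≟_) renaming
    (Carrier to A; _≈_ to _~_; refl to ~-refl; sym to ~-sym; trans to ~-trans)

  reps : List A
  reps = deduplicate _≟_ xs

  reps⊆ : reps ⊆ xs
  reps⊆ = ∈-deduplicate⁻ _≟_ xs

  reps-apart : ∀ {s t} → s ∈ reps → t ∈ reps → s ~ t → s ≡ t
  reps-apart = apart (DecUniqueₚ.deduplicate-! D xs)
    where
    apart : ∀ {ys s t} → AllPairs (λ x y → ¬ x ~ y) ys → s ∈ ys → t ∈ ys → s ~ t → s ≡ t
    apart (y≁ ∷ _)     (here refl) (here refl) _   = refl
    apart (y≁ ∷ _)     (here refl) (there t∈)  s~t = contradiction s~t (All.lookup y≁ t∈)
    apart (y≁ ∷ _)     (there s∈)  (here refl) s~t = contradiction (~-sym s~t) (All.lookup y≁ s∈)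
    apart (_ ∷ ys-sep) (there s∈)  (there t∈)  s~t = apart ys-sep s∈ t∈ s~t

  reps-unique : Unique reps
  reps-unique = AllPairs.map (λ { s≁t refl → s≁t ~-refl }) (DecUniqueₚ.deduplicate-! D xs)

  represented : ∀ {x} → x ∈ xs → ∃[ t ] (t ∈ reps × t ~ x)
  represented {x} x∈ =
    find (Anyₚ.deduplicate⁺ _≟_ (λ y~z z~x → ~-trans y~z z~x) (lose {P = _~ x} x∈ ~-refl))

-- Permutation groups and their orbits

module _ {n : ℕ} where

  _≟ₚ_ : DecidableEquality (Perm n)
  _≟ₚ_ = ≡-dec Finₚ._≟_

  *-act : (a b : Perm n) (i : Fin n) → (a * b) ·ₚ i ≡ a ·ₚ (b ·ₚ i)
  *-act a b i = lookup∘tabulate _ i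

  idP-act : (i : Fin n) → idP ·ₚ i ≡ i
  idP-act i = lookup∘tabulate id i

  perm-ext : {a b : Perm n} → (∀ i → a ·ₚ i ≡ b ·ₚ i) → a ≡ b
  perm-ext {a} {b} eq = begin
    a                         ≡⟨ tabulate∘lookup a ⟨
    Vec.tabulate (lookup a)   ≡⟨ tabulate-cong eq ⟩
    Vec.tabulate (lookup b)   ≡⟨ tabulate∘lookup b ⟩
    b                         ∎
    where open ≡-Reasoning

  *-assoc : (a b c : Perm n) → (a * b) * c ≡ a * (b * c)
  *-assoc a b c = perm-ext λ i → begin
    ((a * b) * c) ·ₚ i      ≡⟨ *-act (a * b) c i ⟩
    (a * b) ·ₚ (c ·ₚ i)     ≡⟨ *-act a b _ ⟩
    a ·ₚ (b ·ₚ (c ·ₚ i))    ≡⟨ cong (a ·ₚ_) (*-act b c i) ⟨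
    a ·ₚ ((b * c) ·ₚ i)     ≡⟨ *-act a (b * c) i ⟨
    (a * (b * c)) ·ₚ i      ∎
    where open ≡-Reasoning

  *-identityˡ : (a : Perm n) → idP * a ≡ a
  *-identityˡ a = perm-ext λ i → trans (*-act idP a i) (idP-act _)

  *-identityʳ : (a : Perm n) → a * idP ≡ a
  *-identityʳ a = perm-ext λ i → trans (*-act a idP i) (cong (a ·ₚ_) (idP-act i))

  *-monoid : Monoid 0ℓ 0ℓ
  *-monoid = record
    { Carrier = Perm n ; _≈_ = _≡_ ; _∙_ = _*_ ; ε = idP
    ; isMonoid = record
      { isSemigroup = record
        { isMagma = record { isEquivalence = isEquivalence ; ∙-cong = cong₂ _*_ }
        ; assoc = *-assoc }
      ; identity = *-identityˡ , *-identityʳ } }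

  module *-Monoid = MonoidProperties *-monoid

  ^ₚ-+ : (a : Perm n) (k l : ℕ) → a ^ₚ (k ℕ.+ l) ≡ (a ^ₚ k) * (a ^ₚ l)
  ^ₚ-+ a zero    l = sym (*-identityˡ _)
  ^ₚ-+ a (suc k) l = trans (cong (a *_) (^ₚ-+ a k l)) (sym (*-assoc a (a ^ₚ k) (a ^ₚ l)))

  infix 4 _Fixes_ _Moves_

  _Fixes_ _Moves_ : Perm n → Fin n → Set
  a Fixes i = a ·ₚ i ≡ i
  a Moves i = ¬ (a Fixes i)

  moved-point : {a : Perm n} → a ≢ idP → ∃[ i ] (a Moves i)
  moved-point {a} a≢1 with Finₚ.any? (λ i → ¬? ((a ·ₚ i) Finₚ.≟ i))
  ... | yes found = found
  ... | no  none  = contradiction (perm-ext fixes-all) a≢1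
    where
    fixes-all : ∀ i → a ·ₚ i ≡ idP ·ₚ i
    fixes-all i = trans
      (decidable-stable ((a ·ₚ i) Finₚ.≟ i) (λ moves → none (i , moves))) (sym (idP-act i))

  *-fixes : (a b : Perm n) {i : Fin n} → a Fixes i → b Fixes i → a * b Fixes i
  *-fixes a b {i} a-fixes b-fixes = trans (*-act a b i) (trans (cong (a ·ₚ_) b-fixes) a-fixes)

  *-moves : (a b : Perm n) {i : Fin n} → a Moves i → b Fixes i → a * b Moves i
  *-moves a b {i} a-moves b-fixes ab-fixes =
    a-moves (trans (cong (a ·ₚ_) (sym b-fixes)) (trans (sym (*-act a b i)) ab-fixes))

  ^ₚ-fixes : (a : Perm n) {i : Fin n} → a Fixes i → ∀ k → a ^ₚ k Fixes i
  ^ₚ-fixes a a-fixes zero    = idP-act _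
  ^ₚ-fixes a a-fixes (suc k) = *-fixes a (a ^ₚ k) a-fixes (^ₚ-fixes a a-fixes k)

  ^ₚ-multiple-fixes : (a : Perm n) {i : Fin n} (k : ℕ) → a ^ₚ k Fixes i →
    ∀ x → a ^ₚ (x ℕ.* k) Fixes i
  ^ₚ-multiple-fixes a     k a^k-fixes zero    = idP-act _
  ^ₚ-multiple-fixes a {i} k a^k-fixes (suc x) = subst (_Fixes i) (sym (^ₚ-+ a k (x ℕ.* k)))
    (*-fixes (a ^ₚ k) (a ^ₚ (x ℕ.* k)) a^k-fixes (^ₚ-multiple-fixes a k a^k-fixes x))

  consecutive-powers-fix⇒fixes : {a : Perm n} {i : Fin n} {k l : ℕ} →
    a ^ₚ k Fixes i → 1 ℕ.+ k ≡ l → a ^ₚ l Fixes i → a Fixes i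
  consecutive-powers-fix⇒fixes {a} {i} {k} k-fixes refl 1+k-fixes = begin
    a ·ₚ i                ≡⟨ cong (a ·ₚ_) k-fixes ⟨
    a ·ₚ ((a ^ₚ k) ·ₚ i)  ≡⟨ *-act a (a ^ₚ k) i ⟨
    (a ^ₚ suc k) ·ₚ i     ≡⟨ 1+k-fixes ⟩
    i                     ∎
    where open ≡-Reasoning

  coprime-powers-fix⇒fixes : (a : Perm n) {i : Fin n} (k l : ℕ) → Coprime k l →
    a ^ₚ k Fixes i → a ^ₚ l Fixes i → a Fixes i
  coprime-powers-fix⇒fixes a {i} k l k⊥l k-fixes l-fixes with coprime-Bézout k⊥l
  ... | Bézout.+- x y 1+yl≡xk = consecutive-powers-fix⇒fixes
    (^ₚ-multiple-fixes a l l-fixes y) 1+yl≡xk (^ₚ-multiple-fixes a k k-fixes x)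
  ... | Bézout.-+ x y 1+xk≡yl = consecutive-powers-fix⇒fixes
    (^ₚ-multiple-fixes a k k-fixes x) 1+xk≡yl (^ₚ-multiple-fixes a l l-fixes y)

module SubgroupProperties {n : ℕ} (K : Subgroup n) where

  ^ₚ-closed : {a : Perm n} → a ∈ˢ K → (k : ℕ) → (a ^ₚ k) ∈ˢ K
  ^ₚ-closed a∈ zero    = has-id K
  ^ₚ-closed a∈ (suc k) = mul-closed K a∈ (^ₚ-closed a∈ k)

  module _ {a : Perm n} (a∈ : a ∈ˢ K) where

    inv : Perm n
    inv = proj₁ (inv-closed K a∈)

    inv∈ : inv ∈ˢ K
    inv∈ = proj₁ (proj₂ (inv-closed K a∈))

    *-inverseʳ : a * inv ≡ idP
    *-inverseʳ = proj₂ (proj₂ (inv-closed K a∈))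

  *-inverseˡ : {a : Perm n} (a∈ : a ∈ˢ K) → inv a∈ * a ≡ idP
  *-inverseˡ {a} a∈ = begin
    inv a∈ * a              ≡⟨ cong (inv a∈ *_) a≡a⁻¹⁻¹ ⟩
    inv a∈ * inv (inv∈ a∈)  ≡⟨ *-inverseʳ (inv∈ a∈) ⟩
    idP                     ∎
    where
    open ≡-Reasoning
    a≡a⁻¹⁻¹ : a ≡ inv (inv∈ a∈)
    a≡a⁻¹⁻¹ = begin
      a                              ≡⟨ *-identityʳ a ⟨
      a * idP                        ≡⟨ cong (a *_) (*-inverseʳ (inv∈ a∈)) ⟨
      a * (inv a∈ * inv (inv∈ a∈))   ≡⟨ *-assoc a (inv a∈) (inv (inv∈ a∈)) ⟨
      (a * inv a∈) * inv (inv∈ a∈)   ≡⟨ *-Monoid.elimˡ (*-inverseʳ a∈) _ ⟩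
      inv (inv∈ a∈)                  ∎

  module _ {a : Perm n} (a∈ : a ∈ˢ K) where

    act-inv : (i : Fin n) → a ·ₚ (inv a∈ ·ₚ i) ≡ i
    act-inv i = trans (sym (*-act a (inv a∈) i)) (trans (cong (_·ₚ i) (*-inverseʳ a∈)) (idP-act i))

    inv-act : (i : Fin n) → inv a∈ ·ₚ (a ·ₚ i) ≡ i
    inv-act i = trans (sym (*-act (inv a∈) a i)) (trans (cong (_·ₚ i) (*-inverseˡ a∈)) (idP-act i))

    inv-*-cancelˡ : (b : Perm n) → inv a∈ * (a * b) ≡ b
    inv-*-cancelˡ = *-Monoid.cancelˡ {a = inv a∈} {c = a} (*-inverseˡ a∈)

    *-inv-cancelˡ : (b : Perm n) → a * (inv a∈ * b) ≡ b
    *-inv-cancelˡ = *-Monoid.cancelˡ {a = a} {c = inv a∈} (*-inverseʳ a∈)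

    *-inv-cancelʳ : (b : Perm n) → (b * a) * inv a∈ ≡ b
    *-inv-cancelʳ = *-Monoid.cancelʳ {a = a} {c = inv a∈} (*-inverseʳ a∈)

    inv-*-cancelʳ : (b : Perm n) → (b * inv a∈) * a ≡ b
    inv-*-cancelʳ = *-Monoid.cancelʳ {a = inv a∈} {c = a} (*-inverseˡ a∈)

    *-cancelˡ : {b c : Perm n} → a * b ≡ a * c → b ≡ c
    *-cancelˡ {b} {c} eq = begin
      b                  ≡⟨ inv-*-cancelˡ b ⟨
      inv a∈ * (a * b)   ≡⟨ cong (inv a∈ *_) eq ⟩
      inv a∈ * (a * c)   ≡⟨ inv-*-cancelˡ c ⟩
      c                  ∎
      where open ≡-Reasoning

    *-cancelʳ : {b c : Perm n} → b * a ≡ c * a → b ≡ c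
    *-cancelʳ {b} {c} eq = begin
      b                  ≡⟨ *-inv-cancelʳ b ⟨
      (b * a) * inv a∈   ≡⟨ cong (_* inv a∈) eq ⟩
      (c * a) * inv a∈   ≡⟨ *-inv-cancelʳ c ⟩
      c                  ∎
      where open ≡-Reasoning

    quotient∈ : {b : Perm n} → b ∈ˢ K → (inv a∈ * b) ∈ˢ K
    quotient∈ = mul-closed K (inv∈ a∈)

    quotient-fixes : (b : Perm n) {i : Fin n} → b ·ₚ i ≡ a ·ₚ i → inv a∈ * b Fixes i
    quotient-fixes b {i} eq = trans (*-act (inv a∈) b i) (trans (cong (inv a∈ ·ₚ_) eq) (inv-act i))

trivialSubgroup : (n : ℕ) → Subgroup n
trivialSubgroup n = record
  { elems      = idP ∷ []
  ; unique     = [] ∷ []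
  ; perms      = λ { (here refl) i j eq → trans (sym (idP-act i)) (trans eq (idP-act j)) }
  ; has-id     = here refl
  ; mul-closed = λ { (here refl) (here refl) → here (*-identityˡ idP) }
  ; inv-closed = λ { (here refl) → idP , here refl , *-identityˡ idP }
  }

module Orbits {n : ℕ} (K : Subgroup n) {X : Set} (_≟_ : DecidableEquality X)
  (_▷_ : Perm n → X → X) (▷-identity : ∀ x → idP ▷ x ≡ x)
  (▷-assoc : ∀ a b x → (a * b) ▷ x ≡ a ▷ (b ▷ x)) where

  open SubgroupProperties K

  record Orbit (x y : X) : Set where
    constructor via
    field
      {mover} : Perm n
      mover∈  : mover ∈ˢ K
      moves   : mover ▷ x ≡ y

  open Orbit public

  orbit? : ∀ x y → Dec (Orbit x y)
  orbit? x y = map′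
    (λ found → let (_ , a∈ , ax≡y) = find found in via a∈ ax≡y)
    (λ { (via a∈ ax≡y) → lose a∈ ax≡y })
    (Any.any? (λ a → (a ▷ x) ≟ y) (elems K))

  orbit-refl : ∀ {x} → Orbit x x
  orbit-refl = via (has-id K) (▷-identity _)

  orbit-sym : ∀ {x y} → Orbit x y → Orbit y x
  orbit-sym {x} (via {a} a∈ refl) = via (inv∈ a∈)
    (trans (sym (▷-assoc (inv a∈) a x)) (trans (cong (_▷ x) (*-inverseˡ a∈)) (▷-identity x)))

  orbit-trans : ∀ {x y z} → Orbit x y → Orbit y z → Orbit x z
  orbit-trans {x} (via {a} a∈ refl) (via {b} b∈ refl) = via (mul-closed K b∈ a∈) (▷-assoc b a x)

  orbit-decSetoid : DecSetoid 0ℓ 0ℓ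
  orbit-decSetoid = record
    { Carrier = X ; _≈_ = Orbit
    ; isDecEquivalence = record
      { isEquivalence = record { refl = orbit-refl ; sym = orbit-sym ; trans = orbit-trans }
      ; _≟_ = orbit? } }

module PointOrbits {n : ℕ} (K : Subgroup n) where
  open Orbits K Finₚ._≟_ _·ₚ_ idP-act *-act public
  open Transversal orbit-decSetoid (allFin n) public

module Cosets {n : ℕ} (S G : Subgroup n) (S≤G : S ≤ˢ G) where

  open SubgroupProperties G
  open Orbits S _≟ₚ_ _*_ *-identityˡ *-assoc public renaming
    (Orbit to _~_; orbit-refl to ~-refl; orbit-sym to ~-sym; orbit-trans to ~-trans)
  open Transversal orbit-decSetoid (elems G) public

  ~-*ʳ : ∀ {a b} c → a ~ b → (a * c) ~ (b * c)
  ~-*ʳ {a} c (via {s} s∈ refl) = via s∈ (sym (*-assoc s a c))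

  index : ℕ
  index = length reps

  order-*-index : order S ℕ.* index ≡ order G
  order-*-index = length-*-bijection _*_ (unique S) reps-unique (unique G)
    (λ s∈ t∈ → mul-closed G (S≤G s∈) (reps⊆ t∈))
    (λ a∈ → let (t , t∈ , via s∈ st≡a) = represented a∈ in _ , t , s∈ , t∈ , sym st≡a)
    *-injective
    where
    *-injective : ∀ {s t s′ t′} → s ∈ˢ S → t ∈ reps → s′ ∈ˢ S → t′ ∈ reps →
      s * t ≡ s′ * t′ → s ≡ s′ × t ≡ t′
    *-injective s∈ t∈ s′∈ t′∈ eq
      with refl ← reps-apart t∈ t′∈ (~-trans (via s∈ eq) (~-sym (via s′∈ refl))) =
      *-cancelʳ (reps⊆ t∈) eq , refl

  index-nonZero : ℕ.NonZero index
  index-nonZero = ℕ.>-nonZero (∈-length (proj₁ (proj₂ (represented (has-id G)))))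

  IsFactorization : Perm n → Perm n × Perm n → Set
  IsFactorization a (s , t) = s ∈ˢ S × t ∈ reps × s * t ≡ a

  factorizations : ∃[ f ] (∀ {a} → a ∈ˢ G → IsFactorization a (f a))
  factorizations = choice _≟ₚ_ (idP , idP) {P = IsFactorization} λ a∈ →
    let (t , t∈ , via {s} s∈ st≡a) = represented a∈ in (s , t) , s∈ , t∈ , st≡a

  pre rep : Perm n → Perm n
  pre a = proj₁ (proj₁ factorizations a)
  rep a = proj₂ (proj₁ factorizations a)

  pre∈ : ∀ {a} → a ∈ˢ G → pre a ∈ˢ S
  pre∈ a∈ = proj₁ (proj₂ factorizations a∈)

  rep∈ : ∀ {a} → a ∈ˢ G → rep a ∈ reps
  rep∈ a∈ = proj₁ (proj₂ (proj₂ factorizations a∈))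

  pre*rep : ∀ {a} → a ∈ˢ G → pre a * rep a ≡ a
  pre*rep a∈ = proj₂ (proj₂ (proj₂ factorizations a∈))

  rep~ : ∀ {a} → a ∈ˢ G → rep a ~ a
  rep~ a∈ = via (pre∈ a∈) (pre*rep a∈)

  rep-cong : ∀ {a b} → a ∈ˢ G → b ∈ˢ G → a ~ b → rep a ≡ rep b
  rep-cong a∈ b∈ a~b = reps-apart (rep∈ a∈) (rep∈ b∈)
    (~-trans (rep~ a∈) (~-trans a~b (~-sym (rep~ b∈))))

  module _ {s a : Perm n} (s∈ : s ∈ˢ S) (a∈ : a ∈ˢ G) where

    rep-translate : rep (s * a) ≡ rep a
    rep-translate = sym (rep-cong a∈ (mul-closed G (S≤G s∈) a∈) (via s∈ refl))

    pre-translate : pre (s * a) ≡ s * pre a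
    pre-translate = *-cancelʳ (reps⊆ (rep∈ a∈)) (begin
      pre (s * a) * rep a        ≡⟨ cong (pre (s * a) *_) rep-translate ⟨
      pre (s * a) * rep (s * a)  ≡⟨ pre*rep (mul-closed G (S≤G s∈) a∈) ⟩
      s * a                      ≡⟨ cong (s *_) (pre*rep a∈) ⟨
      s * (pre a * rep a)        ≡⟨ *-assoc s (pre a) (rep a) ⟨
      (s * pre a) * rep a        ∎)
      where open ≡-Reasoning

  rep-*-↭ : ∀ {b} → b ∈ˢ G → map (λ t → rep (t * b)) reps ↭ reps
  rep-*-↭ {b} b∈ = injective-endo-↭ reps-unique (λ t∈ → rep∈ (tb∈ t∈)) injective
    where
    tb∈ : ∀ {t} → t ∈ reps → (t * b) ∈ˢ G
    tb∈ t∈ = mul-closed G (reps⊆ t∈) b∈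
    injective : ∀ {s t} → s ∈ reps → t ∈ reps → rep (s * b) ≡ rep (t * b) → s ≡ t
    injective {s} {t} s∈ t∈ eq = reps-apart s∈ t∈
      (subst₂ _~_ (*-inv-cancelʳ b∈ s) (*-inv-cancelʳ b∈ t) (~-*ʳ (inv b∈) sb~tb))
      where
      sb~tb : (s * b) ~ (t * b)
      sb~tb = ~-trans (~-sym (rep~ (tb∈ s∈))) (subst (_~ (t * b)) (sym eq) (rep~ (tb∈ t∈)))

-- Functions modulo N and modulo constants

variable
  N : ℤ

infix 4 _≈_[mod_] _≃_[mod_]

record _≈_[mod_] (x y N : ℤ) : Set where
  constructor congruent
  field divides-difference : N ∣ᶻ x - y

open _≈_[mod_]

≈-by : ∀ {x y x′ y′} → x ≈ y [mod N ] → x - y ≡ x′ - y′ → x′ ≈ y′ [mod N ]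
≈-by {N} (congruent d) eq = congruent (subst (N ∣ᶻ_) eq d)

≈-reflexive : ∀ {x y} → x ≡ y → x ≈ y [mod N ]
≈-reflexive {x = x} refl = congruent (ℤᵈ.divides 0ℤ (ℤₚ.+-inverseʳ x))

≈-refl : ∀ {x} → x ≈ x [mod N ]
≈-refl = ≈-reflexive refl

infixl 6 _⟨+⟩_ _⟨-⟩_
infixr 7 _⟨·⟩_

_⟨+⟩_ : ∀ {x y x′ y′} → x ≈ y [mod N ] → x′ ≈ y′ [mod N ] → x + x′ ≈ y + y′ [mod N ]
_⟨+⟩_ {N} {x} {y} {x′} {y′} (congruent d) (congruent d′) =
  congruent (subst (N ∣ᶻ_) (regroup x y x′ y′) (∣m∣n⇒∣m+n d d′))
  where
  regroup : ∀ x y x′ y′ → (x - y) + (x′ - y′) ≡ (x + x′) - (y + y′)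
  regroup = solve-∀

_⟨·⟩_ : ∀ {x y} k → x ≈ y [mod N ] → k · x ≈ k · y [mod N ]
_⟨·⟩_ {N} {x} {y} k (congruent d) = congruent (subst (N ∣ᶻ_) (distrib k x y) (∣n⇒∣m*n k d))
  where
  distrib : ∀ k x y → k · (x - y) ≡ k · x - k · y
  distrib = solve-∀

≈-sym : ∀ {x y} → x ≈ y [mod N ] → y ≈ x [mod N ]
≈-sym {x = x} {y} eq = ≈-by (ℤ.-1ℤ ⟨·⟩ eq) (negate x y)
  where
  negate : ∀ x y → ℤ.-1ℤ · x - ℤ.-1ℤ · y ≡ y - x
  negate = solve-∀

_⟨-⟩_ : ∀ {x y x′ y′} → x ≈ y [mod N ] → x′ ≈ y′ [mod N ] → x - x′ ≈ y - y′ [mod N ]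
_⟨-⟩_ {x = x} {y} {x′} {y′} eq eq′ = ≈-by (eq ⟨+⟩ ≈-sym eq′) (regroup x y x′ y′)
  where
  regroup : ∀ x y x′ y′ → (x + y′) - (y + x′) ≡ (x - x′) - (y - y′)
  regroup = solve-∀

≈-trans : ∀ {x y z} → x ≈ y [mod N ] → y ≈ z [mod N ] → x ≈ z [mod N ]
≈-trans {x = x} {y} {z} p q = ≈-by (p ⟨+⟩ q) (telescope x y z)
  where
  telescope : ∀ x y z → (x + y) - (y + z) ≡ x - z
  telescope = solve-∀

≈-setoid : ℤ → Setoid 0ℓ 0ℓ
≈-setoid N = record
  { Carrier = ℤ ; _≈_ = _≈_[mod N ]
  ; isEquivalence = record { refl = ≈-refl ; sym = ≈-sym ; trans = ≈-trans } }

≈-mod-0⇒≡ : ∀ {x y} → x ≈ y [mod 0ℤ ] → x ≡ y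
≈-mod-0⇒≡ {x} {y} (congruent d) = ℤₚ.i-j≡0⇒i≡j x y (0∣⇒≡0 d)

module _ {X : Set} where

  infixl 6 _⊞_ _⊟_
  infixr 7 _⊙_

  _⊞_ _⊟_ : (X → ℤ) → (X → ℤ) → X → ℤ
  (u ⊞ v) i = u i + v i
  (u ⊟ v) i = u i - v i

  _⊙_ : ℤ → (X → ℤ) → X → ℤ
  (k ⊙ u) i = k · u i

-- u and v represent the same element of ℤ^X / (N ℤ^X + constants).
record _≃_[mod_] {X : Set} (u v : X → ℤ) (N : ℤ) : Set where
  constructor same-differences
  field differences : ∀ i j → u i - u j ≈ v i - v j [mod N ]

open _≃_[mod_] public

module _ {X : Set} where

  ≃-by : {u v u′ v′ : X → ℤ} → u ≃ v [mod N ] → (∀ i → u i - v i ≡ u′ i - v′ i) → u′ ≃ v′ [mod N ]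
  ≃-by {u = u} {v} {u′} {v′} (same-differences d) eq = same-differences λ i j → ≈-by (d i j) (begin
    (u i - u j) - (v i - v j)          ≡⟨ exchange (u i) (u j) (v i) (v j) ⟩
    (u i - v i) - (u j - v j)          ≡⟨ cong₂ _-_ (eq i) (eq j) ⟩
    (u′ i - v′ i) - (u′ j - v′ j)      ≡⟨ exchange (u′ i) (v′ i) (u′ j) (v′ j) ⟩
    (u′ i - u′ j) - (v′ i - v′ j)      ∎)
    where
    open ≡-Reasoning
    exchange : ∀ a b c d → (a - b) - (c - d) ≡ (a - c) - (b - d)
    exchange = solve-∀

  ≃-reflexive : {u v : X → ℤ} → (∀ i → u i ≡ v i) → u ≃ v [mod N ]
  ≃-reflexive eq = same-differences λ i j → ≈-reflexive (cong₂ _-_ (eq i) (eq j))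

  ≃-refl : {u : X → ℤ} → u ≃ u [mod N ]
  ≃-refl = ≃-reflexive λ _ → refl

  ≃-constant : {c d : ℤ} → (λ (_ : X) → c) ≃ (λ _ → d) [mod N ]
  ≃-constant {c = c} {d} = same-differences λ i j →
    ≈-reflexive (trans (ℤₚ.+-inverseʳ c) (sym (ℤₚ.+-inverseʳ d)))

  infixl 6 _⟪+⟫_ _⟪-⟫_
  infixr 7 _⟪·⟫_

  _⟪+⟫_ : {u v u′ v′ : X → ℤ} → u ≃ v [mod N ] → u′ ≃ v′ [mod N ] → u ⊞ u′ ≃ v ⊞ v′ [mod N ]
  _⟪+⟫_ {u = u} {v} {u′} {v′} (same-differences d) (same-differences d′) = same-differences λ i j →
    ≈-by (d i j ⟨+⟩ d′ i j)
      (regroup (u i) (u j) (u′ i) (u′ j) (v i) (v j) (v′ i) (v′ j))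
    where
    regroup : ∀ a b c d a′ b′ c′ d′ →
      ((a - b) + (c - d)) - ((a′ - b′) + (c′ - d′)) ≡ ((a + c) - (b + d)) - ((a′ + c′) - (b′ + d′))
    regroup = solve-∀

  _⟪·⟫_ : {u v : X → ℤ} (k : ℤ) → u ≃ v [mod N ] → k ⊙ u ≃ k ⊙ v [mod N ]
  _⟪·⟫_ {u = u} {v} k (same-differences d) = same-differences λ i j →
    ≈-by (k ⟨·⟩ d i j) (distrib k (u i) (u j) (v i) (v j))
    where
    distrib : ∀ k a b c d → k · (a - b) - k · (c - d) ≡ (k · a - k · b) - (k · c - k · d)
    distrib = solve-∀

  ≃-sym : {u v : X → ℤ} → u ≃ v [mod N ] → v ≃ u [mod N ]
  ≃-sym (same-differences d) = same-differences λ i j → ≈-sym (d i j)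

  ≃-trans : {u v w : X → ℤ} → u ≃ v [mod N ] → v ≃ w [mod N ] → u ≃ w [mod N ]
  ≃-trans (same-differences d) (same-differences e) =
    same-differences λ i j → ≈-trans (d i j) (e i j)

  ≃-setoid : ℤ → Setoid 0ℓ 0ℓ
  ≃-setoid N = record
    { Carrier = X → ℤ ; _≈_ = _≃_[mod N ]
    ; isEquivalence = record { refl = ≃-refl ; sym = ≃-sym ; trans = ≃-trans } }

  _⟪-⟫_ : {u v u′ v′ : X → ℤ} → u ≃ v [mod N ] → u′ ≃ v′ [mod N ] → u ⊟ u′ ≃ v ⊟ v′ [mod N ]
  _⟪-⟫_ {u = u} {v} {u′} {v′} p q = ≃-by (p ⟪+⟫ ≃-sym q) λ i → regroup (u i) (v i) (u′ i) (v′ i)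
    where
    regroup : ∀ a b c d → (a + d) - (b + c) ≡ (a - c) - (b - d)
    regroup = solve-∀

  lift-mod-0 : X → {u v : X → ℤ} → u ≃ v [mod N ] → ∃[ x ] (u ≃ v ⊞ (N ⊙ x) [mod 0ℤ ])
  lift-mod-0 {N} i₀ {u} {v} (same-differences d) = x , same-differences λ i j → ≈-reflexive (begin
    u i - u j                          ≡⟨ regroup (u i) (v i) (u j) (v j) (u i₀ - v i₀) ⟩
    v i + Δ i - (v j + Δ j)            ≡⟨ cong₂ (λ p q → v i + p - (v j + q)) (Nx i) (Nx j) ⟨
    v i + N · x i - (v j + N · x j)    ∎)
    where
    open ≡-Reasoning
    x Δ : X → ℤ
    x i = ℤᵈ.quotient (divides-difference (d i i₀))
    Δ i = u i - v i - (u i₀ - v i₀)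
    Nx : ∀ i → N · x i ≡ Δ i
    Nx i = begin
      N · x i                           ≡⟨ ℤₚ.*-comm N (x i) ⟩
      x i · N                           ≡⟨ ℤᵈ._∣_.equality (divides-difference (d i i₀)) ⟨
      (u i - u i₀) - (v i - v i₀)       ≡⟨ exchange (u i) (u i₀) (v i) (v i₀) ⟩
      Δ i                               ∎
      where
      exchange : ∀ a b c d → (a - b) - (c - d) ≡ (a - c) - (b - d)
      exchange = solve-∀
    regroup : ∀ a b c d e → a - c ≡ b + (a - b - e) - (d + (c - d - e))
    regroup = solve-∀

  multiple⇒≃0 : {u v : X → ℤ} → N ⊙ u ≃ v [mod 0ℤ ] → v ≃ (λ _ → 0ℤ) [mod N ]
  multiple⇒≃0 {N} {u} {v} (same-differences d) = same-differences λ i j →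
    congruent (ℤᵈ.divides (u i - u j) (begin
      v i - v j - (0ℤ - 0ℤ)       ≡⟨ ℤₚ.+-identityʳ (v i - v j) ⟩
      v i - v j                   ≡⟨ ≈-mod-0⇒≡ (d i j) ⟨
      N · u i - N · u j           ≡⟨ factor N (u i) (u j) ⟩
      (u i - u j) · N             ∎))
    where
    open ≡-Reasoning
    factor : ∀ n x y → n · x - n · y ≡ (x - y) · n
    factor = solve-∀

  ⊙-cancel : {u v : X → ℤ} (k : ℤ) .{{_ : ℤ.NonZero k}} →
    k ⊙ u ≃ k ⊙ v [mod 0ℤ ] → u ≃ v [mod 0ℤ ]
  ⊙-cancel {u} {v} k (same-differences d) = same-differences λ i j → ≈-reflexive
    (ℤₚ.*-cancelˡ-≡ k _ _ (begin
      k · (u i - u j)        ≡⟨ distrib k (u i) (u j) ⟩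
      k · u i - k · u j      ≡⟨ ≈-mod-0⇒≡ (d i j) ⟩
      k · v i - k · v j      ≡⟨ distrib k (v i) (v j) ⟨
      k · (v i - v j)        ∎))
    where
    open ≡-Reasoning
    distrib : ∀ k x y → k · (x - y) ≡ k · x - k · y
    distrib = solve-∀

infixl 8 _◃_

_◃_ : ∀ {n} → (Fin n → ℤ) → Perm n → Fin n → ℤ
(u ◃ a) i = u (a ·ₚ i)

◃-cong : ∀ {n} {u v : Fin n → ℤ} a → u ≃ v [mod N ] → u ◃ a ≃ v ◃ a [mod N ]
◃-cong a (same-differences d) = same-differences λ i j → d (a ·ₚ i) (a ·ₚ j)

∑ : {A : Set} → List A → (A → ℤ) → ℤ
∑ xs f = foldr _+_ 0ℤ (map f xs)

∑-map-↭ : {A : Set} {g : A → A} {xs : List A} (f : A → ℤ) → map g xs ↭ xs → ∑ xs (f ∘ g) ≡ ∑ xs f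
∑-map-↭ {xs = xs} f p = trans (cong (foldr _+_ 0ℤ) (map-∘ xs))
  (Permutationₛ.foldr-commMonoid (setoid ℤ) ℤₚ.+-0-isCommutativeMonoid (↭⇒↭ₛ (map⁺ f p)))

∑-distrib-+ : {A : Set} (f g : A → ℤ) (xs : List A) → ∑ xs (f ⊞ g) ≡ ∑ xs f + ∑ xs g
∑-distrib-+ f g []       = refl
∑-distrib-+ f g (x ∷ xs) =
  trans (cong (f x + g x +_) (∑-distrib-+ f g xs)) (exchange (f x) (g x) (∑ xs f) (∑ xs g))
  where
  exchange : ∀ a b c d → a + b + (c + d) ≡ a + c + (b + d)
  exchange = solve-∀

∑-const : {A : Set} (c : ℤ) (xs : List A) → ∑ xs (λ _ → c) ≡ ℤ.+ length xs · c
∑-const c []       = refl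
∑-const c (x ∷ xs) = trans (cong (c +_) (∑-const c xs)) (factor c (ℤ.+ length xs))
  where
  factor : ∀ c l → c + l · c ≡ (ℤ.1ℤ + l) · c
  factor = solve-∀

∑-cong-≃ : {A X : Set} {P Q : A → X → ℤ} (xs : List A) → (∀ {x} → x ∈ xs → P x ≃ Q x [mod N ]) →
  (λ i → ∑ xs λ x → P x i) ≃ (λ i → ∑ xs λ x → Q x i) [mod N ]
∑-cong-≃ []       eq = ≃-reflexive λ _ → refl
∑-cong-≃ (x ∷ xs) eq = eq (here refl) ⟪+⟫ ∑-cong-≃ xs (eq ∘ there)

-- Cohomology with coefficients in functions on points

C¹ C² : ℕ → Set
C¹ n = Perm n → Fin n → ℤ
C² n = Perm n → Perm n → Fin n → ℤ

δ : ∀ {n} → C¹ n → C² n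
δ Φ a b = (Φ b ⊟ Φ (a * b)) ⊞ (Φ a ◃ b)

-- Cocycles and coboundaries of K with values in ℤⁿ / (N ℤⁿ + constants), on which K acts from
-- the right by ◃. The case N = 0 is that of J.
module _ {n : ℕ} (N : ℤ) (K : Subgroup n) where

  Z¹ B¹ : C¹ n → Set
  Z¹ V = ∀ {a b} → a ∈ˢ K → b ∈ˢ K → V (a * b) ≃ (V a ◃ b) ⊞ V b [mod N ]
  B¹ V = ∃[ w ] (∀ {a} → a ∈ˢ K → V a ≃ (w ◃ a) ⊟ w [mod N ])

  Cobounds : C¹ n → C² n → Set
  Cobounds Φ F = ∀ {a b} → a ∈ˢ K → b ∈ˢ K → F a b ≃ δ Φ a b [mod N ]

  Z² B² : C² n → Set
  Z² F = ∀ {a b c} → a ∈ˢ K → b ∈ˢ K → c ∈ˢ K →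
    (F a b ◃ c) ⊞ F (a * b) c ≃ F a (b * c) ⊞ F b c [mod N ]
  B² F = ∃[ Φ ] Cobounds Φ F

infixr 7 _⊙²_

_⊙²_ : ∀ {n} → ℤ → C² n → C² n
(k ⊙² F) a b = k ⊙ F a b

module Transfer {n : ℕ} (S G : Subgroup n) (S≤G : S ≤ˢ G) {F : C² n} (F-cocycle : Z² N G F) where

  open Cosets S G S≤G

  module _ (φ : C¹ n) (φ-bounds : Cobounds N S φ F) where

    -- By Ψ-bounds, φ and Ψ trivialize F on S × G. Hence P a, which inherits the cocycle identity
    -- of F a, depends only on the coset of a, and the sum of P over all cosets bounds index ⊙² F.
    Ψ : C¹ n
    Ψ a = (φ (pre a) ◃ rep a) ⊟ F (pre a) (rep a)

    Ψ-bounds : ∀ {s a} → s ∈ˢ S → a ∈ˢ G → F s a ≃ (Ψ a ⊟ Ψ (s * a)) ⊞ (φ s ◃ a) [mod N ]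
    Ψ-bounds {s} {a} s∈ a∈ = ≃-by
      (≃-sym (F-cocycle (S≤G s∈) (S≤G (pre∈ a∈)) (reps⊆ (rep∈ a∈)))
        ⟪+⟫ ◃-cong t (φ-bounds s∈ (pre∈ a∈)))
      λ i → begin
        F s (p * t) i + F p t i + F s p (t ·ₚ i)
          - (F s p (t ·ₚ i) + F (s * p) t i
              + (φ p (t ·ₚ i) - φ (s * p) (t ·ₚ i) + φ s (p ·ₚ (t ·ₚ i))))
          ≡⟨ regroup (F s (p * t) i) (F p t i) (F s p (t ·ₚ i)) (F (s * p) t i)
               (φ p (t ·ₚ i)) (φ (s * p) (t ·ₚ i)) (φ s (p ·ₚ (t ·ₚ i))) ⟩
        F s (p * t) i - (Ψ a i - (φ (s * p) (t ·ₚ i) - F (s * p) t i) + φ s (p ·ₚ (t ·ₚ i)))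
          ≡⟨ cong₂ (λ x j → F s (p * t) i - (Ψ a i - x + φ s j)) (Ψ-translate i) (*-act p t i) ⟨
        F s (p * t) i - (Ψ a i - Ψ (s * a) i + φ s ((p * t) ·ₚ i))
          ≡⟨ cong (λ b → F s b i - (Ψ a i - Ψ (s * a) i + φ s (b ·ₚ i))) (pre*rep a∈) ⟩
        F s a i - (Ψ a i - Ψ (s * a) i + φ s (a ·ₚ i)) ∎
      where
      open ≡-Reasoning
      p t : Perm n
      p = pre a
      t = rep a
      Ψ-translate : ∀ i → Ψ (s * a) i ≡ φ (s * p) (t ·ₚ i) - F (s * p) t i
      Ψ-translate i =
        cong₂ (λ x y → φ x (y ·ₚ i) - F x y i) (pre-translate s∈ a∈) (rep-translate s∈ a∈)
      regroup : ∀ x y z w u v q → x + y + z - (z + w + (u - v + q)) ≡ x - ((u - y) - (v - w) + q)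
      regroup = solve-∀

    P : C² n
    P a b = (F a b ⊞ Ψ (a * b)) ⊟ (Ψ a ◃ b)

    P-invariant : ∀ {s a b} → s ∈ˢ S → a ∈ˢ G → b ∈ˢ G → P (s * a) b ≃ P a b [mod N ]
    P-invariant {s} {a} {b} s∈ a∈ b∈ = ≃-by
      (F-cocycle (S≤G s∈) a∈ b∈ ⟪+⟫ Ψ-bounds s∈ (mul-closed G a∈ b∈) ⟪-⟫ ◃-cong b (Ψ-bounds s∈ a∈))
      λ i → trans
        (cong₂ (λ c j → F s a (b ·ₚ i) + F (s * a) b i + F s (a * b) i - F s a (b ·ₚ i)
                  - (F s (a * b) i + F a b i + (Ψ (a * b) i - Ψ c i + φ s j)
                     - (Ψ a (b ·ₚ i) - Ψ (s * a) (b ·ₚ i) + φ s (a ·ₚ (b ·ₚ i)))))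
          (sym (*-assoc s a b)) (*-act a b i))
        (regroup (F s a (b ·ₚ i)) (F (s * a) b i) (F s (a * b) i) (F a b i) (Ψ (a * b) i)
          (Ψ ((s * a) * b) i) (φ s (a ·ₚ (b ·ₚ i))) (Ψ a (b ·ₚ i)) (Ψ (s * a) (b ·ₚ i)))
      where
      regroup : ∀ x y z f u v w p q →
        x + y + z - x - (z + f + (u - v + w) - (p - q + w)) ≡ (y + v - q) - (f + u - p)
      regroup = solve-∀

    P-cong-~ : ∀ {a b c} → a ∈ˢ G → c ∈ˢ G → a ~ b → P a c ≃ P b c [mod N ]
    P-cong-~ a∈ c∈ (via s∈ refl) = ≃-sym (P-invariant s∈ a∈ c∈)

    P-cocycle : ∀ {a b c} → a ∈ˢ G → b ∈ˢ G → c ∈ˢ G →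
      (P a b ◃ c) ⊞ P (a * b) c ≃ P a (b * c) ⊞ F b c [mod N ]
    P-cocycle {a} {b} {c} a∈ b∈ c∈ = ≃-by (F-cocycle a∈ b∈ c∈) λ i → trans
      (regroup (F a b (c ·ₚ i)) (F (a * b) c i) (F a (b * c) i) (F b c i)
        (Ψ (a * b) (c ·ₚ i)) (Ψ a (b ·ₚ (c ·ₚ i))) (Ψ (a * (b * c)) i))
      (cong₂ (λ d j → F a b (c ·ₚ i) + Ψ (a * b) (c ·ₚ i) - Ψ a (b ·ₚ (c ·ₚ i))
               + (F (a * b) c i + Ψ d i - Ψ (a * b) (c ·ₚ i))
               - (F a (b * c) i + Ψ (a * (b * c)) i - Ψ a j + F b c i))
        (sym (*-assoc a b c)) (sym (*-act b c i)))
      where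
      regroup : ∀ x y z f u v w →
        x + y - (z + f) ≡ x + u - v + (y + w - u) - (z + w - v + f)
      regroup = solve-∀

    U : C¹ n
    U b i = ∑ reps λ t → P t b i

    U-translate : ∀ {b c} → b ∈ˢ G → c ∈ˢ G → (λ i → ∑ reps λ t → P (t * b) c i) ≃ U c [mod N ]
    U-translate {b} {c} b∈ c∈ = begin
      (λ i → ∑ reps λ t → P (t * b) c i)
        ≈⟨ ∑-cong-≃ reps to-rep ⟩
      (λ i → ∑ reps λ t → P (rep (t * b)) c i)
        ≈⟨ ≃-reflexive (λ i → ∑-map-↭ (λ t → P t c i) (rep-*-↭ b∈)) ⟩
      U c ∎
      where
      open SetoidReasoning (≃-setoid N)
      to-rep : ∀ {t} → t ∈ reps → P (t * b) c ≃ P (rep (t * b)) c [mod N ]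
      to-rep t∈ = let tb∈ = mul-closed G (reps⊆ t∈) b∈ in P-cong-~ tb∈ c∈ (~-sym (rep~ tb∈))

    U-cocycle : ∀ {b c} → b ∈ˢ G → c ∈ˢ G →
      (U b ◃ c) ⊞ U c ≃ U (b * c) ⊞ (ℤ.+ index ⊙ F b c) [mod N ]
    U-cocycle {b} {c} b∈ c∈ = begin
      (U b ◃ c) ⊞ U c
        ≈⟨ ≃-refl {u = U b ◃ c} ⟪+⟫ ≃-sym (U-translate b∈ c∈) ⟩
      (U b ◃ c) ⊞ (λ i → ∑ reps λ t → P (t * b) c i)
        ≈⟨ ≃-reflexive (λ i → ∑-distrib-+ (λ t → P t b (c ·ₚ i)) (λ t → P (t * b) c i) reps) ⟨
      (λ i → ∑ reps λ t → ((P t b ◃ c) ⊞ P (t * b) c) i)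
        ≈⟨ ∑-cong-≃ reps (λ t∈ → P-cocycle (reps⊆ t∈) b∈ c∈) ⟩
      (λ i → ∑ reps λ t → (P t (b * c) ⊞ F b c) i)
        ≈⟨ ≃-reflexive (λ i → ∑-distrib-+ (λ t → P t (b * c) i) (λ _ → F b c i) reps) ⟩
      U (b * c) ⊞ (λ i → ∑ reps λ _ → F b c i)
        ≈⟨ ≃-refl {u = U (b * c)} ⟪+⟫ ≃-reflexive (λ i → ∑-const (F b c i) reps) ⟩
      U (b * c) ⊞ (ℤ.+ index ⊙ F b c) ∎
      where open SetoidReasoning (≃-setoid N)

    U-bounds : Cobounds N G U (ℤ.+ index ⊙² F)
    U-bounds {b} {c} b∈ c∈ = ≃-by (≃-sym (U-cocycle b∈ c∈)) λ i →
      regroup (U b (c ·ₚ i)) (U c i) (U (b * c) i) (ℤ.+ index · F b c i)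
      where
      regroup : ∀ x y z f → z + f - (x + y) ≡ f - (y - z + x)
      regroup = solve-∀

  transfer : B² N S F → B² N G (ℤ.+ index ⊙² F)
  transfer (φ , φ-bounds) = U φ φ-bounds , U-bounds φ φ-bounds

trivialSubgroup-≤ : ∀ {n} (K : Subgroup n) → trivialSubgroup n ≤ˢ K
trivialSubgroup-≤ K (here refl) = has-id K

B²-trivialSubgroup : ∀ {n} {F : C² n} → B² N (trivialSubgroup n) F
B²-trivialSubgroup {F = F} = (λ _ → F idP idP) , λ { (here refl) (here refl) → ≃-reflexive λ i →
  trans (cong (F idP idP) (sym (idP-act i))) (telescope (F idP idP i) (F idP idP (idP ·ₚ i))) }
  where
  telescope : ∀ x y → y ≡ x - x + y
  telescope = solve-∀

nonzero-multiple∈B² : ∀ {n} (K : Subgroup n) {F : C² n} → Z² N K F →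
  ∃[ r ] (ℤ.NonZero r × B² N K (r ⊙² F))
nonzero-multiple∈B² {n = n} K F-cocycle = ℤ.+ index , index-nonZero ,
  Transfer.transfer (trivialSubgroup n) K (trivialSubgroup-≤ K) F-cocycle B²-trivialSubgroup
  where open Cosets (trivialSubgroup n) K (trivialSubgroup-≤ K)

module _ {n : ℕ} where

  δ-principal-⊞ : (w : Fin n → ℤ) (Φ : C¹ n) (a b : Perm n) →
    δ (λ c → ((w ◃ c) ⊟ w) ⊞ Φ c) a b ≃ δ Φ a b [mod N ]
  δ-principal-⊞ w Φ a b = ≃-reflexive λ i → trans
    (cong (λ j → w (b ·ₚ i) - w i + Φ b i - (w j - w i + Φ (a * b) i)
             + (w (a ·ₚ (b ·ₚ i)) - w (b ·ₚ i) + Φ a (b ·ₚ i))) (*-act a b i))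
    (cancel (w (a ·ₚ (b ·ₚ i))) (w (b ·ₚ i)) (w i) (Φ b i) (Φ (a * b) i) (Φ a (b ·ₚ i)))
    where
    cancel : ∀ wab wb w p q r → wb - w + p - (wab - w + q) + (wab - wb + r) ≡ p - q + r
    cancel = solve-∀

  δ-⊙ : (k : ℤ) (Φ : C¹ n) (a b : Perm n) → δ (λ c → k ⊙ Φ c) a b ≃ k ⊙ δ Φ a b [mod N ]
  δ-⊙ k Φ a b = ≃-reflexive λ i → factor k (Φ b i) (Φ (a * b) i) (Φ a (b ·ₚ i))
    where
    factor : ∀ k x y z → k · x - k · y + k · z ≡ k · (x - y + z)
    factor = solve-∀

module _ {n : ℕ} {K : Subgroup n} where

  δ-cong : {Φ Ψ : C¹ n} → (∀ {a} → a ∈ˢ K → Φ a ≃ Ψ a [mod N ]) →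
    ∀ {a b} → a ∈ˢ K → b ∈ˢ K → δ Φ a b ≃ δ Ψ a b [mod N ]
  δ-cong eq {b = b} a∈ b∈ = eq b∈ ⟪-⟫ eq (mul-closed K a∈ b∈) ⟪+⟫ ◃-cong b (eq a∈)

  coprime-multiples∈B²⇒∈B² : {F : C² n} {k l : ℕ} → Coprime k l →
    B² N K (ℤ.+ k ⊙² F) → B² N K (ℤ.+ l ⊙² F) → B² N K F
  coprime-multiples∈B²⇒∈B² {F = F} {k} {l} k⊥l (Φ , Φ-bounds) (Ψ , Ψ-bounds)
    with x , y , xk+yl≡1 ← coprime⇒bézout k⊥l =
    (λ a → (x ⊙ Φ a) ⊞ (y ⊙ Ψ a)) , λ {a} {b} a∈ b∈ →
    ≃-by (x ⟪·⟫ Φ-bounds a∈ b∈ ⟪+⟫ y ⟪·⟫ Ψ-bounds a∈ b∈) λ i → trans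
      (regroup x y (ℤ.+ k) (ℤ.+ l) (F a b i) (Φ b i) (Φ (a * b) i) (Φ a (b ·ₚ i))
        (Ψ b i) (Ψ (a * b) i) (Ψ a (b ·ₚ i)))
      (cong (_- δ (λ a → (x ⊙ Φ a) ⊞ (y ⊙ Ψ a)) a b i)
        (trans (cong (_· F a b i) xk+yl≡1) (ℤₚ.*-identityˡ (F a b i))))
    where
    regroup : ∀ x y k l f p q r p′ q′ r′ →
      x · (k · f) + y · (l · f) - (x · (p - q + r) + y · (p′ - q′ + r′))
      ≡ (x · k + y · l) · f - ((x · p + y · p′) - (x · q + y · q′) + (x · r + y · r′))
    regroup = solve-∀

  cobounds-multiple⇒Z¹ : {F : C² n} {V : C¹ n} → Cobounds 0ℤ K V (N ⊙² F) → Z¹ N K V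
  cobounds-multiple⇒Z¹ {V = V} V-bounds {a} {b} a∈ b∈ =
    ≃-by (≃-sym (multiple⇒≃0 (V-bounds a∈ b∈))) λ i →
      regroup (V b i) (V (a * b) i) (V a (b ·ₚ i))
    where
    regroup : ∀ x y z → 0ℤ - (x - y + z) ≡ y - (z + x)
    regroup = solve-∀

  bockstein : .{{_ : ℤ.NonZero N}} → Fin n → {F : C² n} {V : C¹ n} →
    Cobounds 0ℤ K V (N ⊙² F) → B¹ N K V → B² 0ℤ K F
  bockstein {N} i₀ {F} {V} V-bounds (w , V≃dw)
    with Φ , V≃dw+NΦ ← choice _≟ₚ_ (λ _ → 0ℤ) (λ a∈ → lift-mod-0 i₀ (V≃dw a∈)) =
    Φ , λ {a} {b} a∈ b∈ → ⊙-cancel N (begin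
      N ⊙ F a b                                          ≈⟨ V-bounds a∈ b∈ ⟩
      δ V a b                                            ≈⟨ δ-cong V≃dw+NΦ a∈ b∈ ⟩
      δ (λ c → ((w ◃ c) ⊟ w) ⊞ (N ⊙ Φ c)) a b            ≈⟨ δ-principal-⊞ w (λ c → N ⊙ Φ c) a b ⟩
      δ (λ c → N ⊙ Φ c) a b                              ≈⟨ δ-⊙ N Φ a b ⟩
      N ⊙ δ Φ a b                                        ∎)
    where open SetoidReasoning (≃-setoid 0ℤ)

module _ {n : ℕ} (K : Subgroup n) where

  open SubgroupProperties K

  module _ {V : C¹ n} (V-cocycle : Z¹ N K V) where

    Z¹-idP : V idP ≃ (λ _ → 0ℤ) [mod N ]
    Z¹-idP = ≃-by (≃-sym (V-cocycle (has-id K) (has-id K))) λ i → begin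
      V idP (idP ·ₚ i) + V idP i - V (idP * idP) i
        ≡⟨ cong₂ (λ j a → V idP j + V idP i - V a i) (idP-act i) (*-identityˡ idP) ⟩
      V idP i + V idP i - V idP i
        ≡⟨ regroup (V idP i) ⟩
      V idP i - 0ℤ ∎
      where
      open ≡-Reasoning
      regroup : ∀ x → x + x - x ≡ x - 0ℤ
      regroup = solve-∀

    Z¹-^ₚ : ∀ {a i j} → a ∈ˢ K → a Fixes i → a Fixes j → ∀ k →
      V (a ^ₚ k) i - V (a ^ₚ k) j ≈ ℤ.+ k · (V a i - V a j) [mod N ]
    Z¹-^ₚ {i = i} {j} a∈ i-fixed j-fixed zero = differences Z¹-idP i j
    Z¹-^ₚ {a} {i} {j} a∈ i-fixed j-fixed (suc k) =
      ≈-by (differences (V-cocycle a∈ (^ₚ-closed a∈ k)) i j ⟨+⟩ Z¹-^ₚ a∈ i-fixed j-fixed k) (begin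
        V (a ^ₚ suc k) i - V (a ^ₚ suc k) j + (V (a ^ₚ k) i - V (a ^ₚ k) j)
          - (V a ((a ^ₚ k) ·ₚ i) + V (a ^ₚ k) i - (V a ((a ^ₚ k) ·ₚ j) + V (a ^ₚ k) j)
             + ℤ.+ k · (V a i - V a j))
          ≡⟨ cong₂ (λ x y → V (a ^ₚ suc k) i - V (a ^ₚ suc k) j + (V (a ^ₚ k) i - V (a ^ₚ k) j)
               - (V a x + V (a ^ₚ k) i - (V a y + V (a ^ₚ k) j) + ℤ.+ k · (V a i - V a j)))
               (^ₚ-fixes a i-fixed k) (^ₚ-fixes a j-fixed k) ⟩
        V (a ^ₚ suc k) i - V (a ^ₚ suc k) j + (V (a ^ₚ k) i - V (a ^ₚ k) j)
          - (V a i + V (a ^ₚ k) i - (V a j + V (a ^ₚ k) j) + ℤ.+ k · (V a i - V a j))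
          ≡⟨ regroup (V (a ^ₚ suc k) i - V (a ^ₚ suc k) j) (V (a ^ₚ k) i) (V (a ^ₚ k) j)
               (V a i) (V a j) (ℤ.+ k) ⟩
        V (a ^ₚ suc k) i - V (a ^ₚ suc k) j - (ℤ.1ℤ + ℤ.+ k) · (V a i - V a j) ∎)
      where
      open ≡-Reasoning
      regroup : ∀ d x y u v k →
        d + (x - y) - (u + x - (v + y) + k · (u - v)) ≡ d - (ℤ.1ℤ + k) · (u - v)
      regroup = solve-∀

  Z¹-mod-0-fixed-points : {D : C¹ n} → Z¹ 0ℤ K D → ∀ {a i j} m .{{_ : ℕ.NonZero m}} →
    a ∈ˢ K → a ^ₚ m ≡ idP → a Fixes i → a Fixes j → D a i ≡ D a j
  Z¹-mod-0-fixed-points {D} D-cocycle {a} {i} {j} m a∈ a^m≡1 i-fixed j-fixed =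
    ℤₚ.i-j≡0⇒i≡j (D a i) (D a j) (ℤₚ.*-cancelˡ-≡ (ℤ.+ m) _ _ (begin
      ℤ.+ m · (D a i - D a j)          ≡⟨ ≈-mod-0⇒≡ (Z¹-^ₚ {V = D} D-cocycle a∈ i-fixed j-fixed m) ⟨
      D (a ^ₚ m) i - D (a ^ₚ m) j      ≡⟨ cong (λ b → D b i - D b j) a^m≡1 ⟩
      D idP i - D idP j                ≡⟨ ≈-mod-0⇒≡ (differences (Z¹-idP {V = D} D-cocycle) i j) ⟩
      0ℤ                               ≡⟨ ℤₚ.*-zeroʳ (ℤ.+ m) ⟨
      ℤ.+ m · 0ℤ                       ∎))
    where open ≡-Reasoning

  -- Over ℤ, D = V - N Φ is a crossed homomorphism, so aᵏ ↦ D aᵏ i - D aᵏ j is a homomorphism from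
  -- a finite group to ℤ.
  ∈B²⇒fixed-points-agree : {F : C² n} {V : C¹ n} → Cobounds 0ℤ K V (N ⊙² F) → B² 0ℤ K F →
    ∀ {a i j} m .{{_ : ℕ.NonZero m}} → a ∈ˢ K → a ^ₚ m ≡ idP → a Fixes i → a Fixes j →
    V a i ≈ V a j [mod N ]
  ∈B²⇒fixed-points-agree {N} {F} {V} V-bounds (Φ , Φ-bounds) {a} {i} {j} m a∈ a^m≡1 i-fixed j-fixed
    = congruent (ℤᵈ.divides (Φ a i - Φ a j) (begin
      V a i - V a j
        ≡⟨ regroup N (V a i) (V a j) (Φ a i) (Φ a j) ⟩
      D a i - D a j + (Φ a i - Φ a j) · N
        ≡⟨ cong (_+ (Φ a i - Φ a j) · N) (ℤₚ.i≡j⇒i-j≡0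
             (Z¹-mod-0-fixed-points {D} D-cocycle m a∈ a^m≡1 i-fixed j-fixed)) ⟩
      0ℤ + (Φ a i - Φ a j) · N
        ≡⟨ ℤₚ.+-identityˡ _ ⟩
      (Φ a i - Φ a j) · N ∎))
    where
    open ≡-Reasoning
    D : C¹ n
    D a = V a ⊟ (N ⊙ Φ a)
    D-cocycle : Z¹ 0ℤ K D
    D-cocycle {a} {b} a∈ b∈ = ≃-by (V-bounds a∈ b∈ ⟪-⟫ N ⟪·⟫ Φ-bounds a∈ b∈) λ i →
      rearrange N (F a b i) (V b i) (V (a * b) i) (V a (b ·ₚ i))
        (Φ b i) (Φ (a * b) i) (Φ a (b ·ₚ i))
      where
      rearrange : ∀ n f vb vab va pb pab pa →
        n · f - n · f - ((vb - vab + va) - n · (pb - pab + pa))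
        ≡ (vab - n · pab) - ((va - n · pa) + (vb - n · pb))
      rearrange = solve-∀
    regroup : ∀ n v v′ p p′ → v - v′ ≡ (v - n · p) - (v′ - n · p′) + (p - p′) · n
    regroup = solve-∀

-- Splitting crossed homomorphisms of abelian groups

module _ {n : ℕ} (S : Subgroup n) where

  open SubgroupProperties S

  module _ {τ : C¹ n} {a b : Perm n} {i : Fin n} (b∈ : b ∈ˢ S) (ai≡bi : a ·ₚ i ≡ b ·ₚ i)
    (τ-* : τ (b * (inv b∈ * a)) i ≈ τ b ((inv b∈ * a) ·ₚ i) + τ (inv b∈ * a) i [mod N ]) where

    cocycle-quotient : τ a i ≈ τ b i + τ (inv b∈ * a) i [mod N ]
    cocycle-quotient = begin
      τ a i                                            ≡⟨ cong (λ c → τ c i) (*-inv-cancelˡ b∈ a) ⟨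
      τ (b * (inv b∈ * a)) i                           ≈⟨ τ-* ⟩
      τ b ((inv b∈ * a) ·ₚ i) + τ (inv b∈ * a) i       ≡⟨ cong (λ j → τ b j + τ (inv b∈ * a) i)
                                                            (quotient-fixes b∈ a ai≡bi) ⟩
      τ b i + τ (inv b∈ * a) i                         ∎
      where open SetoidReasoning (≈-setoid _)

    vanishing-quotient⇒≈ : τ (inv b∈ * a) i ≈ 0ℤ [mod N ] → τ a i ≈ τ b i [mod N ]
    vanishing-quotient⇒≈ vanishes = begin
      τ a i                        ≈⟨ cocycle-quotient ⟩
      τ b i + τ (inv b∈ * a) i     ≈⟨ ≈-refl {x = τ b i} ⟨+⟩ vanishes ⟩
      τ b i + 0ℤ                   ≡⟨ ℤₚ.+-identityʳ (τ b i) ⟩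
      τ b i                        ∎
      where open SetoidReasoning (≈-setoid _)

-- Shapiro's lemma: H¹(S, (ℤ/N)ⁿ) is the sum of the groups Hom(Sᵢ, ℤ/N) over representatives i
-- of the orbits of S.
module Shapiro {n : ℕ} (S : Subgroup n) {σ : C¹ n}
  (σ-* : ∀ {a b} → a ∈ˢ S → b ∈ˢ S → ∀ i → σ (a * b) i ≈ σ a (b ·ₚ i) + σ b i [mod N ])
  (σ-vanishes : ∀ {a i} → a ∈ˢ S → a Fixes i → σ a i ≈ 0ℤ [mod N ]) where

  open SubgroupProperties S
  open PointOrbits S

  base : Fin n → Fin n
  base i = proj₁ (represented (∈-allFin i))

  base∈reps : ∀ i → base i ∈ reps
  base∈reps i = proj₁ (proj₂ (represented (∈-allFin i)))

  base-orbit : ∀ i → Orbit (base i) i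
  base-orbit i = proj₂ (proj₂ (represented (∈-allFin i)))

  base-act : ∀ {a} → a ∈ˢ S → ∀ i → base (a ·ₚ i) ≡ base i
  base-act {a} a∈ i = reps-apart (base∈reps (a ·ₚ i)) (base∈reps i)
    (orbit-trans (base-orbit (a ·ₚ i)) (orbit-sym (orbit-trans (base-orbit i) (via a∈ refl))))

  from-base : Fin n → Perm n
  from-base i = mover (base-orbit i)

  from-base∈ : ∀ i → from-base i ∈ˢ S
  from-base∈ i = mover∈ (base-orbit i)

  from-base-act : ∀ i → from-base i ·ₚ base i ≡ i
  from-base-act i = moves (base-orbit i)

  from-base-* : ∀ {a} → a ∈ˢ S → ∀ i → from-base (a ·ₚ i) ·ₚ base i ≡ (a * from-base i) ·ₚ base i
  from-base-* {a} a∈ i = begin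
    from-base (a ·ₚ i) ·ₚ base i            ≡⟨ cong (from-base (a ·ₚ i) ·ₚ_) (base-act a∈ i) ⟨
    from-base (a ·ₚ i) ·ₚ base (a ·ₚ i)     ≡⟨ from-base-act (a ·ₚ i) ⟩
    a ·ₚ i                                  ≡⟨ cong (a ·ₚ_) (from-base-act i) ⟨
    a ·ₚ (from-base i ·ₚ base i)            ≡⟨ *-act a (from-base i) (base i) ⟨
    (a * from-base i) ·ₚ base i             ∎
    where open ≡-Reasoning

  σ-cong : ∀ {a b i} → a ∈ˢ S → b ∈ˢ S → a ·ₚ i ≡ b ·ₚ i → σ a i ≈ σ b i [mod N ]
  σ-cong {a} a∈ b∈ ai≡bi = vanishing-quotient⇒≈ S {τ = σ} b∈ ai≡bi
    (σ-* b∈ (quotient∈ b∈ a∈) _)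
    (σ-vanishes (quotient∈ b∈ a∈) (quotient-fixes b∈ a ai≡bi))

  w : Fin n → ℤ
  w i = σ (from-base i) (base i)

  w-act : ∀ {a} → a ∈ˢ S → ∀ i → w (a ·ₚ i) ≈ σ a i + w i [mod N ]
  w-act {a} a∈ i = begin
    σ (from-base (a ·ₚ i)) (base (a ·ₚ i))
      ≡⟨ cong (σ (from-base (a ·ₚ i))) (base-act a∈ i) ⟩
    σ (from-base (a ·ₚ i)) (base i)
      ≈⟨ σ-cong (from-base∈ (a ·ₚ i)) (mul-closed S a∈ (from-base∈ i)) (from-base-* a∈ i) ⟩
    σ (a * from-base i) (base i)
      ≈⟨ σ-* a∈ (from-base∈ i) (base i) ⟩
    σ a (from-base i ·ₚ base i) + w i
      ≡⟨ cong (λ j → σ a j + w i) (from-base-act i) ⟩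
    σ a i + w i ∎
    where open SetoidReasoning (≈-setoid _)

  vanishing-on-stabilizers⇒principal :
    ∃[ w ] (∀ {a} → a ∈ˢ S → ∀ i → σ a i ≈ w (a ·ₚ i) - w i [mod N ])
  vanishing-on-stabilizers⇒principal = w , λ {a} a∈ i →
    ≈-by (≈-sym (w-act a∈ i)) (regroup (σ a i) (w i) (w (a ·ₚ i)))
    where
    regroup : ∀ x y z → x + y - z ≡ x - (z - y)
    regroup = solve-∀

IsAbelian : ∀ {n} → Subgroup n → Set
IsAbelian S = ∀ {a b} → a ∈ˢ S → b ∈ˢ S → a * b ≡ b * a

HasExponent : ∀ {n} → Subgroup n → ℕ → Set
HasExponent S m = ∀ {a} → a ∈ˢ S → a ^ₚ m ≡ idP

FixedPointsAgree : ∀ {n} → ℤ → Subgroup n → C¹ n → Set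
FixedPointsAgree N S V = ∀ {a i j} → a ∈ˢ S → a Fixes i → a Fixes j → V a i ≈ V a j [mod N ]

HasCyclicOrbits : ∀ {n} → Subgroup n → Set
HasCyclicOrbits S = ∀ {e b i} → e ∈ˢ S → b ∈ˢ S → e Moves i → ∃[ k ] ((e ^ₚ k) ·ₚ i ≡ b ·ₚ i)

TransitiveFixing : ∀ {n} → Subgroup n → Fin n → Fin n → Fin n → Set
TransitiveFixing S j k i =
  ∀ {a} → a ∈ˢ S → ∃[ x ] (x ∈ˢ S × x Fixes j × x Fixes k × x ·ₚ i ≡ a ·ₚ i)

record GeneralPosition {n : ℕ} (S : Subgroup n) : Set where
  field
    {i₁ i₂ i₃}    : Fin n
    transitive-i₁ : TransitiveFixing S i₂ i₃ i₁
    transitive-i₃ : TransitiveFixing S i₁ i₂ i₃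

-- The pairs (a , v) with v ≃ V a form a central extension of S by the constants ℤ/N.
module CentralExtension {n : ℕ} (S : Subgroup n) (abelian : IsAbelian S)
  {N : ℤ} {V : C¹ n} (V-cocycle : Z¹ N S V) where

  open SubgroupProperties S

  act-comm : ∀ {a b} → a ∈ˢ S → b ∈ˢ S → ∀ i → a ·ₚ (b ·ₚ i) ≡ b ·ₚ (a ·ₚ i)
  act-comm {a} {b} a∈ b∈ i = begin
    a ·ₚ (b ·ₚ i)   ≡⟨ *-act a b i ⟨
    (a * b) ·ₚ i    ≡⟨ cong (_·ₚ i) (abelian a∈ b∈) ⟩
    (b * a) ·ₚ i    ≡⟨ *-act b a i ⟩
    b ·ₚ (a ·ₚ i)   ∎
    where open ≡-Reasoning

  -- The elements (a , V a) and (b , V b) of the extension commute.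
  Commute : Perm n → Perm n → Set
  Commute a b = ∀ i → V a (b ·ₚ i) + V b i ≈ V b (a ·ₚ i) + V a i [mod N ]

  commute-at : ∀ {a b} → a ∈ˢ S → b ∈ˢ S → ∀ j →
    V a (b ·ₚ j) + V b j ≈ V b (a ·ₚ j) + V a j [mod N ] → Commute a b
  commute-at {a} {b} a∈ b∈ j at-j i = ≈-by
    (at-j ⟨+⟩ differences (V-cocycle b∈ a∈) i j ⟨-⟩ differences (V-cocycle a∈ b∈) i j)
    (trans
      (cong (λ c → V a (b ·ₚ j) + V b j + (V c i - V c j) - (V (a * b) i - V (a * b) j)
               - (V b (a ·ₚ j) + V a j + (V b (a ·ₚ i) + V a i - (V b (a ·ₚ j) + V a j))
                   - (V a (b ·ₚ i) + V b i - (V a (b ·ₚ j) + V b j)))) (abelian b∈ a∈))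
      (regroup (V a (b ·ₚ j) + V b j) (V (a * b) i - V (a * b) j) (V b (a ·ₚ j) + V a j)
        (V b (a ·ₚ i) + V a i) (V a (b ·ₚ i) + V b i)))
    where
    regroup : ∀ x d y y′ x′ → x + d - d - (y + (y′ - y) - (x′ - x)) ≡ x′ - y′
    regroup = solve-∀

  common-fixed-point⇒commute : ∀ {a b j} → a ∈ˢ S → b ∈ˢ S → a Fixes j → b Fixes j → Commute a b
  common-fixed-point⇒commute {a} {b} {j} a∈ b∈ a-fixes b-fixes = commute-at a∈ b∈ j
    (≈-reflexive (begin
      V a (b ·ₚ j) + V b j   ≡⟨ cong (λ k → V a k + V b j) b-fixes ⟩
      V a j + V b j          ≡⟨ ℤₚ.+-comm (V a j) (V b j) ⟩
      V b j + V a j          ≡⟨ cong (λ k → V b k + V a j) a-fixes ⟨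
      V b (a ·ₚ j) + V a j   ∎))
    where open ≡-Reasoning

  commute-* : ∀ {a b c} → a ∈ˢ S → b ∈ˢ S → c ∈ˢ S → Commute a c → Commute b c → Commute (a * b) c
  commute-* {a} {b} {c} a∈ b∈ c∈ ac bc i = ≈-by
    (differences (V-cocycle a∈ b∈) (c ·ₚ i) i ⟨+⟩ ac (b ·ₚ i) ⟨+⟩ bc i)
    (trans
      (cong₂ (λ j k → V (a * b) (c ·ₚ i) - V (a * b) i
                + (V a j + V c (b ·ₚ i)) + (V b (c ·ₚ i) + V c i)
                - (V a (b ·ₚ (c ·ₚ i)) + V b (c ·ₚ i) - (V a (b ·ₚ i) + V b i)
                   + (V c k + V a (b ·ₚ i)) + (V c (b ·ₚ i) + V b i)))
        (act-comm c∈ b∈ i) (sym (*-act a b i)))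
      (regroup (V (a * b) (c ·ₚ i)) (V (a * b) i) (V a (b ·ₚ (c ·ₚ i))) (V c (b ·ₚ i))
        (V b (c ·ₚ i)) (V c i) (V a (b ·ₚ i)) (V b i) (V c ((a * b) ·ₚ i))))
    where
    regroup : ∀ p q x y z u v w t →
      p - q + (x + y) + (z + u) - (x + z - (v + w) + (t + v) + (y + w)) ≡ p + u - (t + q)
    regroup = solve-∀

  -- The lift of a to the extension that vanishes at k.
  lift : Fin n → Perm n → Fin n → ℤ
  lift k a i = V a i - V a k

  lift-* : ∀ {k a b} → a ∈ˢ S → b ∈ˢ S → b Fixes k → ∀ i →
    lift k (a * b) i ≈ lift k a (b ·ₚ i) + lift k b i [mod N ]
  lift-* {k} {a} {b} a∈ b∈ b-fixes i = ≈-by (differences (V-cocycle a∈ b∈) i k)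
    (trans
      (cong (λ j → V (a * b) i - V (a * b) k - (V a (b ·ₚ i) + V b i - (V a j + V b k))) b-fixes)
      (regroup (V (a * b) i - V (a * b) k) (V a (b ·ₚ i)) (V b i) (V a k) (V b k)))
    where
    regroup : ∀ d x y x′ y′ → d - (x + y - (x′ + y′)) ≡ d - (x - x′ + (y - y′))
    regroup = solve-∀

  module _ (agree : FixedPointsAgree N S V) where

    lift-fixes : ∀ {k a i} → a ∈ˢ S → a Fixes k → a Fixes i → lift k a i ≈ 0ℤ [mod N ]
    lift-fixes {k} {a} {i} a∈ fixes-k fixes-i =
      ≈-by (agree a∈ fixes-i fixes-k) (sym (ℤₚ.+-identityʳ (V a i - V a k)))

    lift-cong : ∀ {k a b i} → a ∈ˢ S → b ∈ˢ S → a Fixes k → b Fixes k → a ·ₚ i ≡ b ·ₚ i →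
      lift k a i ≈ lift k b i [mod N ]
    lift-cong {k} {a} {b} {i} a∈ b∈ a-fixes b-fixes ai≡bi =
      vanishing-quotient⇒≈ S {τ = lift k} b∈ ai≡bi
        (lift-* b∈ (quotient∈ b∈ a∈) q-fixes-k i)
        (lift-fixes (quotient∈ b∈ a∈) q-fixes-k (quotient-fixes b∈ a ai≡bi))
      where
      q-fixes-k : inv b∈ * a Fixes k
      q-fixes-k = quotient-fixes b∈ a (trans a-fixes (sym b-fixes))

    module _ (cyclic-orbits : HasCyclicOrbits S) (position : GeneralPosition S) where

      open GeneralPosition position

      Component : Perm n → Perm n → Set
      Component a x = x ∈ˢ S × x Fixes i₁ × x Fixes i₂ × x ·ₚ i₃ ≡ a ·ₚ i₃

      components : Σ[ x ∈ (Perm n → Perm n) ] (∀ {a} → a ∈ˢ S → Component a (x a))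
      components = choice _≟ₚ_ idP {P = Component} transitive-i₃

      x : Perm n → Perm n
      x = proj₁ components

      module _ {a : Perm n} (a∈ : a ∈ˢ S) where

        x∈ : x a ∈ˢ S
        x∈ = proj₁ (proj₂ components a∈)

        x-fixes-i₁ : x a Fixes i₁
        x-fixes-i₁ = proj₁ (proj₂ (proj₂ components a∈))

        x-fixes-i₂ : x a Fixes i₂
        x-fixes-i₂ = proj₁ (proj₂ (proj₂ (proj₂ components a∈)))

        x-i₃ : x a ·ₚ i₃ ≡ a ·ₚ i₃
        x-i₃ = proj₂ (proj₂ (proj₂ (proj₂ components a∈)))

      -- a is a product of an element fixing i₂ and one fixing i₁, and c fixes both points.
      commute-fixing-i₁-i₂ : ∀ {a c} → a ∈ˢ S → c ∈ˢ S → c Fixes i₁ → c Fixes i₂ → Commute a c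
      commute-fixing-i₁-i₂ {a} {c} a∈ c∈ c-fixes-i₁ c-fixes-i₂
        with y , y∈ , y-fixes-i₂ , _ , y-i₁ ← transitive-i₁ a∈ =
        subst (λ b → Commute b c) (*-inv-cancelˡ y∈ a)
          (commute-* y∈ (quotient∈ y∈ a∈) c∈
            (common-fixed-point⇒commute y∈ c∈ y-fixes-i₂ c-fixes-i₂)
            (common-fixed-point⇒commute (quotient∈ y∈ a∈) c∈
              (quotient-fixes y∈ a (sym y-i₁)) c-fixes-i₁))

      x-* : ∀ {a b} → a ∈ˢ S → b ∈ˢ S → x (a * b) ·ₚ i₃ ≡ (x b * x a) ·ₚ i₃
      x-* {a} {b} a∈ b∈ = begin
        x (a * b) ·ₚ i₃        ≡⟨ x-i₃ (mul-closed S a∈ b∈) ⟩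
        (a * b) ·ₚ i₃          ≡⟨ *-act a b i₃ ⟩
        a ·ₚ (b ·ₚ i₃)         ≡⟨ cong (a ·ₚ_) (x-i₃ b∈) ⟨
        a ·ₚ (x b ·ₚ i₃)       ≡⟨ act-comm a∈ (x∈ b∈) i₃ ⟩
        x b ·ₚ (a ·ₚ i₃)       ≡⟨ cong (x b ·ₚ_) (x-i₃ a∈) ⟨
        x b ·ₚ (x a ·ₚ i₃)     ≡⟨ *-act (x b) (x a) i₃ ⟨
        (x b * x a) ·ₚ i₃      ∎
        where open ≡-Reasoning

      χ : Perm n → ℤ
      χ a = lift i₁ (x a) i₃

      χ-* : ∀ {a b} → a ∈ˢ S → b ∈ˢ S → χ (a * b) ≈ lift i₃ a (b ·ₚ i₃) + χ a + χ b [mod N ]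
      χ-* {a} {b} a∈ b∈ = begin
        lift i₁ (x (a * b)) i₃
          ≈⟨ lift-cong (x∈ ab∈) (mul-closed S (x∈ b∈) (x∈ a∈)) (x-fixes-i₁ ab∈)
               (*-fixes (x b) (x a) (x-fixes-i₁ b∈) (x-fixes-i₁ a∈)) (x-* a∈ b∈) ⟩
        lift i₁ (x b * x a) i₃
          ≈⟨ lift-* (x∈ b∈) (x∈ a∈) (x-fixes-i₁ a∈) i₃ ⟩
        lift i₁ (x b) (x a ·ₚ i₃) + χ a
          ≡⟨ cong (λ j → lift i₁ (x b) j + χ a) (x-i₃ a∈) ⟩
        V (x b) (a ·ₚ i₃) - V (x b) i₁ + χ a
          ≈⟨ ≈-by (≈-sym (commute-fixing-i₁-i₂ a∈ (x∈ b∈) (x-fixes-i₁ b∈) (x-fixes-i₂ b∈) i₃))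
               (regroup (V a (x b ·ₚ i₃)) (V (x b) i₃) (V (x b) (a ·ₚ i₃)) (V a i₃) (V (x b) i₁)
                 (χ a)) ⟩
        lift i₃ a (x b ·ₚ i₃) + χ a + χ b
          ≡⟨ cong (λ j → lift i₃ a j + χ a + χ b) (x-i₃ b∈) ⟩
        lift i₃ a (b ·ₚ i₃) + χ a + χ b ∎
        where
        open SetoidReasoning (≈-setoid N)
        ab∈ : (a * b) ∈ˢ S
        ab∈ = mul-closed S a∈ b∈
        regroup : ∀ u v w z t c → w + z - (u + v) ≡ w - t + c - (u - z + c + (v - t))
        regroup = solve-∀

      -- The lift of a that agrees at i₃ with the lift of x a vanishing at i₁.
      σ : C¹ n
      σ a i = lift i₃ a i + χ a

      σ-* : ∀ {a b} → a ∈ˢ S → b ∈ˢ S → ∀ i → σ (a * b) i ≈ σ a (b ·ₚ i) + σ b i [mod N ]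
      σ-* {a} {b} a∈ b∈ i = ≈-by (differences (V-cocycle a∈ b∈) i i₃ ⟨+⟩ χ-* a∈ b∈)
        (regroup (lift i₃ (a * b) i) (χ (a * b)) (V a (b ·ₚ i)) (V b i) (V a (b ·ₚ i₃)) (V b i₃)
          (V a i₃) (χ a) (χ b))
        where
        regroup : ∀ d c p q p₃ q₃ z ca cb →
          d + c - (p + q - (p₃ + q₃) + (p₃ - z + ca + cb)) ≡ d + c - (p - z + ca + (q - q₃ + cb))
        regroup = solve-∀

      VanishesWhereFixed : Perm n → Set
      VanishesWhereFixed a = ∀ {i} → a Fixes i → σ a i ≈ 0ℤ [mod N ]

      vanishes-at⇒vanishes : ∀ {a j} → a ∈ˢ S → a Fixes j → σ a j ≈ 0ℤ [mod N ] →
        VanishesWhereFixed a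
      vanishes-at⇒vanishes {a} {j} a∈ fixes-j at-j {i} fixes-i =
        ≈-by (agree a∈ fixes-i fixes-j ⟨+⟩ at-j)
          (regroup (V a i) (V a j) (V a i₃) (χ a))
        where
        regroup : ∀ vi vj v₃ c → vi + (vj - v₃ + c) - (vj + 0ℤ) ≡ vi - v₃ + c - 0ℤ
        regroup = solve-∀

      fixes-i₃⇒vanishes : ∀ {a} → a ∈ˢ S → a Fixes i₃ → VanishesWhereFixed a
      fixes-i₃⇒vanishes {a} a∈ fixes-i₃ = vanishes-at⇒vanishes a∈ fixes-i₃ (≈-by
        (lift-fixes (x∈ a∈) (x-fixes-i₁ a∈) (trans (x-i₃ a∈) fixes-i₃)) (regroup (V a i₃) (χ a)))
        where
        regroup : ∀ v c → c - 0ℤ ≡ v - v + c - 0ℤ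
        regroup = solve-∀

      fixes-i₁-i₂⇒vanishes : ∀ {a} → a ∈ˢ S → a Fixes i₁ → a Fixes i₂ → VanishesWhereFixed a
      fixes-i₁-i₂⇒vanishes {a} a∈ fixes-i₁ fixes-i₂ = vanishes-at⇒vanishes a∈ fixes-i₁ (≈-by
        (lift-cong (x∈ a∈) a∈ (x-fixes-i₁ a∈) fixes-i₁ (x-i₃ a∈)) (regroup (V a i₁) (V a i₃) (χ a)))
        where
        regroup : ∀ v₁ v₃ c → c - (v₃ - v₁) ≡ v₁ - v₃ + c - 0ℤ
        regroup = solve-∀

      factor-vanishes : ∀ {a b i} → a ∈ˢ S → (b∈ : b ∈ˢ S) → a Fixes i → b Fixes i →
        VanishesWhereFixed b → VanishesWhereFixed (inv b∈ * a) → σ a i ≈ 0ℤ [mod N ]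
      factor-vanishes {a} {b} {i} a∈ b∈ a-fixes b-fixes σb≈0 σq≈0 = ≈-trans
        (cocycle-quotient S {τ = σ} b∈ ai≡bi (σ-* b∈ (quotient∈ b∈ a∈) i))
        (σb≈0 b-fixes ⟨+⟩ σq≈0 (quotient-fixes b∈ a ai≡bi))
        where
        ai≡bi : a ·ₚ i ≡ b ·ₚ i
        ai≡bi = trans a-fixes (sym b-fixes)

      x-fixes⇒vanishes-at : ∀ {a i} → a ∈ˢ S → a Fixes i → x a Fixes i → σ a i ≈ 0ℤ [mod N ]
      x-fixes⇒vanishes-at {a} a∈ a-fixes xa-fixes = factor-vanishes a∈ (x∈ a∈) a-fixes xa-fixes
        (fixes-i₁-i₂⇒vanishes (x∈ a∈) (x-fixes-i₁ a∈) (x-fixes-i₂ a∈))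
        (fixes-i₃⇒vanishes (quotient∈ (x∈ a∈) a∈) (quotient-fixes (x∈ a∈) a (sym (x-i₃ a∈))))

      fixes-i₁⇒vanishes : ∀ {a} → a ∈ˢ S → a Fixes i₁ → VanishesWhereFixed a
      fixes-i₁⇒vanishes a∈ fixes-i₁ =
        vanishes-at⇒vanishes a∈ fixes-i₁ (x-fixes⇒vanishes-at a∈ fixes-i₁ (x-fixes-i₁ a∈))

      fixes-i₂⇒vanishes : ∀ {a} → a ∈ˢ S → a Fixes i₂ → VanishesWhereFixed a
      fixes-i₂⇒vanishes a∈ fixes-i₂ =
        vanishes-at⇒vanishes a∈ fixes-i₂ (x-fixes⇒vanishes-at a∈ fixes-i₂ (x-fixes-i₂ a∈))

      -- If x = x a moves i, its powers are transitive on the orbit of i, so a is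
      -- a product of some y xᵏ fixing i, i₂ and of an element fixing i, i₁.
      σ-vanishes : ∀ {a} → a ∈ˢ S → VanishesWhereFixed a
      σ-vanishes {a} a∈ {i} a-fixes with (x a ·ₚ i) Finₚ.≟ i
      ... | yes xa-fixes = x-fixes⇒vanishes-at a∈ a-fixes xa-fixes
      ... | no  xa-moves
        with y , y∈ , y-fixes-i₂ , _ , y-i₁ ← transitive-i₁ a∈
        with k , xᵏi≡y⁻¹i ← cyclic-orbits (x∈ a∈) (inv∈ y∈) xa-moves =
        factor-vanishes a∈ c∈ a-fixes c-fixes-i
          (fixes-i₂⇒vanishes c∈ (*-fixes y xᵏ y-fixes-i₂ (^ₚ-fixes (x a) (x-fixes-i₂ a∈) k)))
          (fixes-i₁⇒vanishes (quotient∈ c∈ a∈) (quotient-fixes c∈ a (sym c-i₁)))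
        where
        xᵏ c : Perm n
        xᵏ = x a ^ₚ k
        c = y * xᵏ
        c∈ : c ∈ˢ S
        c∈ = mul-closed S y∈ (^ₚ-closed (x∈ a∈) k)
        c-fixes-i : c Fixes i
        c-fixes-i = trans (*-act y xᵏ i) (trans (cong (y ·ₚ_) xᵏi≡y⁻¹i) (act-inv y∈ i))
        c-i₁ : c ·ₚ i₁ ≡ a ·ₚ i₁
        c-i₁ = trans (*-act y xᵏ i₁) (trans (cong (y ·ₚ_) (^ₚ-fixes (x a) (x-fixes-i₁ a∈) k)) y-i₁)

      general-position⇒∈B¹ : B¹ N S V
      general-position⇒∈B¹ = w , λ {a} a∈ → same-differences λ i j →
        ≈-by (σ≈dw a∈ i ⟨-⟩ σ≈dw a∈ j)
          (regroup (V a i) (V a j) (V a i₃) (χ a) (w (a ·ₚ i) - w i) (w (a ·ₚ j) - w j))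
        where
        splitting : ∃[ w ] (∀ {a} → a ∈ˢ S → ∀ i → σ a i ≈ w (a ·ₚ i) - w i [mod N ])
        splitting = Shapiro.vanishing-on-stabilizers⇒principal S {σ} σ-* (λ a∈ → σ-vanishes a∈)
        w : Fin n → ℤ
        w = proj₁ splitting
        σ≈dw : ∀ {a} → a ∈ˢ S → ∀ i → σ a i ≈ w (a ·ₚ i) - w i [mod N ]
        σ≈dw = proj₂ splitting
        regroup : ∀ vi vj v₃ c d e →
          vi - v₃ + c - (vj - v₃ + c) - (d - e) ≡ vi - vj - (d - e)
        regroup = solve-∀

-- Orbits of normal p-subgroups

module OrbitLength {n : ℕ} (S : Subgroup n) (i : Fin n) where

  open SubgroupProperties S
  open PointOrbits S public

  orbit : List (Fin n)
  orbit = filter (orbit? i) (allFin n)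

  ∈-orbit⁺ : ∀ {j} → Orbit i j → j ∈ orbit
  ∈-orbit⁺ = ∈-filter⁺ (orbit? i) (∈-allFin _)

  ∈-orbit⁻ : ∀ {j} → j ∈ orbit → Orbit i j
  ∈-orbit⁻ j∈ = proj₂ (∈-filter⁻ (orbit? i) {xs = allFin n} j∈)

  orbit-unique : Unique orbit
  orbit-unique = Uniqueₚ.filter⁺ (orbit? i) (Uniqueₚ.allFin⁺ n)

  fixes-i? : (a : Perm n) → Dec (a Fixes i)
  fixes-i? a = (a ·ₚ i) Finₚ.≟ i

  stabilizer : List (Perm n)
  stabilizer = filter fixes-i? (elems S)

  ∈-stabilizer⁻ : ∀ {a} → a ∈ stabilizer → a ∈ˢ S × a Fixes i
  ∈-stabilizer⁻ = ∈-filter⁻ fixes-i? {xs = elems S}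

  orbit-stabilizer : length stabilizer ℕ.* length orbit ≡ order S
  orbit-stabilizer = length-*-bijection (λ k o → c o * k)
    (Uniqueₚ.filter⁺ fixes-i? (unique S)) orbit-unique (unique S)
    (λ k∈ o∈ → mul-closed S (c∈ o∈) (proj₁ (∈-stabilizer⁻ k∈))) onto injective
    where
    carriers : Σ[ c ∈ (Fin n → Perm n) ] (∀ {o} → o ∈ orbit → c o ∈ˢ S × c o ·ₚ i ≡ o)
    carriers = choice Finₚ._≟_ idP {P = λ o c → c ∈ˢ S × c ·ₚ i ≡ o}
      λ o∈ → let via c∈ ci≡o = ∈-orbit⁻ o∈ in _ , c∈ , ci≡o
    c : Fin n → Perm n
    c = proj₁ carriers
    c∈ : ∀ {o} → o ∈ orbit → c o ∈ˢ S
    c∈ o∈ = proj₁ (proj₂ carriers o∈)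
    c-i : ∀ {o} → o ∈ orbit → c o ·ₚ i ≡ o
    c-i o∈ = proj₂ (proj₂ carriers o∈)
    onto : ∀ {s} → s ∈ˢ S → ∃[ k ] ∃[ o ] (k ∈ stabilizer × o ∈ orbit × s ≡ c o * k)
    onto {s} s∈ = inv (c∈ o∈) * s , s ·ₚ i ,
      ∈-filter⁺ fixes-i? (quotient∈ (c∈ o∈) s∈) (quotient-fixes (c∈ o∈) s (sym (c-i o∈))) ,
      o∈ , sym (*-inv-cancelˡ (c∈ o∈) s)
      where
      o∈ : s ·ₚ i ∈ orbit
      o∈ = ∈-orbit⁺ (via s∈ refl)
    image : ∀ {k o} → k ∈ stabilizer → o ∈ orbit → (c o * k) ·ₚ i ≡ o
    image {k} {o} k∈ o∈ =
      trans (*-act (c o) k i) (trans (cong (c o ·ₚ_) (proj₂ (∈-stabilizer⁻ k∈))) (c-i o∈))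
    injective : ∀ {k o k′ o′} → k ∈ stabilizer → o ∈ orbit → k′ ∈ stabilizer → o′ ∈ orbit →
      c o * k ≡ c o′ * k′ → k ≡ k′ × o ≡ o′
    injective k∈ o∈ k′∈ o′∈ eq
      with refl ← trans (sym (image k∈ o∈)) (trans (cong (_·ₚ i) eq) (image k′∈ o′∈)) =
      *-cancelˡ (c∈ o∈) eq , refl

module NormalOrbits {n : ℕ} (G S : Subgroup n) (normal : IsNormal G S) where

  private module G = SubgroupProperties G
  open PointOrbits S

  orbit-translate : ∀ {g j k} → g ∈ˢ G → Orbit j k → Orbit (g ·ₚ j) (g ·ₚ k)
  orbit-translate {g} {j} g∈ (via {s} s∈ refl)
    with s′ , s′∈ , gs≡s′g ← normal g∈ s∈ = via s′∈ (begin
    s′ ·ₚ (g ·ₚ j)   ≡⟨ *-act s′ g j ⟨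
    (s′ * g) ·ₚ j    ≡⟨ cong (_·ₚ j) gs≡s′g ⟨
    (g * s) ·ₚ j     ≡⟨ *-act g s j ⟩
    g ·ₚ (s ·ₚ j)    ∎)
    where open ≡-Reasoning

  module _ (transitive : IsTransitive G) (i : Fin n) where

    open OrbitLength S i using (orbit; ∈-orbit⁺; ∈-orbit⁻; orbit-unique)

    g : Fin n → Perm n
    g r = proj₁ (transitive i r)

    g∈ : ∀ r → g r ∈ˢ G
    g∈ r = proj₁ (proj₂ (transitive i r))

    g-i : ∀ r → g r ·ₚ i ≡ r
    g-i r = proj₂ (proj₂ (transitive i r))

    translate-orbit : ∀ r {o} → o ∈ orbit → Orbit r (g r ·ₚ o)
    translate-orbit r {o} o∈ =
      subst (λ j → Orbit j (g r ·ₚ o)) (g-i r) (orbit-translate (g∈ r) (∈-orbit⁻ o∈))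

    ∈-translate : ∀ x → ∃[ o ] ∃[ r ] (o ∈ orbit × r ∈ reps × x ≡ g r ·ₚ o)
    ∈-translate x with r , r∈ , r~x ← represented (∈-allFin x) =
      G.inv (g∈ r) ·ₚ x , r ,
      ∈-orbit⁺ (subst (λ j → Orbit j (G.inv (g∈ r) ·ₚ x)) g⁻¹r≡i
        (orbit-translate (G.inv∈ (g∈ r)) r~x)) ,
      r∈ , sym (G.act-inv (g∈ r) x)
      where
      g⁻¹r≡i : G.inv (g∈ r) ·ₚ r ≡ i
      g⁻¹r≡i = trans (cong (G.inv (g∈ r) ·ₚ_) (sym (g-i r))) (G.inv-act (g∈ r) i)

    translates-disjoint : ∀ {o r o′ r′} → o ∈ orbit → r ∈ reps → o′ ∈ orbit → r′ ∈ reps →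
      g r ·ₚ o ≡ g r′ ·ₚ o′ → o ≡ o′ × r ≡ r′
    translates-disjoint {r = r} {r′ = r′} o∈ r∈ o′∈ r′∈ eq
      with refl ← reps-apart r∈ r′∈
        (orbit-trans (subst (Orbit r) eq (translate-orbit r o∈))
          (orbit-sym (translate-orbit r′ o′∈))) =
      perms G (g∈ r) _ _ eq , refl

    orbit-length∣n : length orbit ∣ n
    orbit-length∣n = divides (length reps) (begin
      n
        ≡⟨ length-tabulate {n = n} id ⟨
      length (allFin n)
        ≡⟨ length-*-bijection (λ o r → g r ·ₚ o) orbit-unique reps-unique (Uniqueₚ.allFin⁺ n)
             (λ _ _ → ∈-allFin _) (λ {x} _ → ∈-translate x) translates-disjoint ⟨
      length orbit ℕ.* length reps
        ≡⟨ ℕₚ.*-comm (length orbit) (length reps) ⟩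
      length reps ℕ.* length orbit ∎)
      where open ≡-Reasoning

module PowerImages {n p : ℕ} (pr : Prime p) (S : Subgroup n) {e : Perm n} (e∈ : e ∈ˢ S)
  (e^p≡1 : e ^ₚ p ≡ idP) {i : Fin n} (e-moves : e Moves i) where

  open SubgroupProperties S

  ^ₚ-image-distinct : ∀ {k l} → k ℕ.< l → l ℕ.< p → (e ^ₚ k) ·ₚ i ≢ (e ^ₚ l) ·ₚ i
  ^ₚ-image-distinct {k} {l} k<l l<p eq = e-moves
    (coprime-powers-fix⇒fixes e p (l ℕ.∸ k) p⊥l-k e^p-fixes e^l-k-fixes)
    where
    p⊥l-k : Coprime p (l ℕ.∸ k)
    p⊥l-k = prime⇒coprime pr {{ℕ.>-nonZero (ℕₚ.m<n⇒0<n∸m k<l)}} (ℕₚ.≤-<-trans (ℕₚ.m∸n≤m l k) l<p)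
    e^p-fixes : e ^ₚ p Fixes i
    e^p-fixes = trans (cong (_·ₚ i) e^p≡1) (idP-act i)
    e^l-k-fixes : e ^ₚ (l ℕ.∸ k) Fixes i
    e^l-k-fixes = perms S (^ₚ-closed e∈ k) _ _ (begin
      (e ^ₚ k) ·ₚ ((e ^ₚ (l ℕ.∸ k)) ·ₚ i)  ≡⟨ *-act (e ^ₚ k) (e ^ₚ (l ℕ.∸ k)) i ⟨
      ((e ^ₚ k) * (e ^ₚ (l ℕ.∸ k))) ·ₚ i   ≡⟨ cong (_·ₚ i) (^ₚ-+ e k (l ℕ.∸ k)) ⟨
      (e ^ₚ (k ℕ.+ (l ℕ.∸ k))) ·ₚ i        ≡⟨ cong (λ m → (e ^ₚ m) ·ₚ i)
                                                (ℕₚ.m+[n∸m]≡n (ℕₚ.<⇒≤ k<l)) ⟩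
      (e ^ₚ l) ·ₚ i                        ≡⟨ eq ⟨
      (e ^ₚ k) ·ₚ i                        ∎)
      where open ≡-Reasoning

  images : List (Fin n)
  images = map (λ k → (e ^ₚ k) ·ₚ i) (upTo p)

  images-unique : Unique images
  images-unique = map-unique injective (Uniqueₚ.upTo⁺ p)
    where
    injective : ∀ {k l} → k ∈ upTo p → l ∈ upTo p → (e ^ₚ k) ·ₚ i ≡ (e ^ₚ l) ·ₚ i → k ≡ l
    injective {k} {l} k∈ l∈ eq with ℕₚ.<-cmp k l
    ... | tri< k<l _ _ = contradiction eq (^ₚ-image-distinct k<l (∈-upTo⁻ l∈))
    ... | tri≈ _ k≡l _ = k≡l
    ... | tri> _ _ l<k = contradiction (sym eq) (^ₚ-image-distinct l<k (∈-upTo⁻ k∈))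

  length-images : length images ≡ p
  length-images = trans (length-map _ (upTo p)) (length-upTo p)

normal-p-subgroup⇒cyclic-orbits : ∀ {n p v} → Prime p → ¬ (p ^ 2 ∣ n) →
  (G S : Subgroup n) → IsNormal G S → IsTransitive G → order S ≡ p ^ v →
  HasExponent S p → HasCyclicOrbits S
normal-p-subgroup⇒cyclic-orbits {p = p} {v} pr p²∤n G S normal transitive |S|≡pᵛ exponent
  {e} {b} {i} e∈ b∈ e-moves =
  let (k , _ , bi≡eᵏi) = ∈-map⁻ (λ k → (e ^ₚ k) ·ₚ i)
        (∈-resp-↭ orbit↭images (∈-orbit⁺ (via b∈ refl)))
  in k , sym bi≡eᵏi
  where
  open OrbitLength S i
  open SubgroupProperties S
  open PowerImages pr S e∈ (exponent e∈) e-moves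
  orbit-length≤p : length orbit ℕ.≤ p
  orbit-length≤p = ∣p^v∧p²∤⇒≤p pr v
    (divides (length stabilizer) (trans (sym |S|≡pᵛ) (sym orbit-stabilizer)))
    (λ p²∣ → p²∤n (∣-trans p²∣ (NormalOrbits.orbit-length∣n G S normal transitive i)))
  images⊆orbit : images ⊆ orbit
  images⊆orbit x∈ with k , _ , refl ← ∈-map⁻ (λ k → (e ^ₚ k) ·ₚ i) x∈ =
    ∈-orbit⁺ (via (^ₚ-closed e∈ k) refl)
  orbit↭images : orbit ↭ images
  orbit↭images = unique∧⊆∧length≤⇒↭ images-unique images⊆orbit
    (subst (length orbit ℕ.≤_) (sym length-images) orbit-length≤p)

record IndependentTriple {n : ℕ} (S : Subgroup n) : Set where
  field
    {a₁ a₂ a₃}      : Perm n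
    a₁∈             : a₁ ∈ˢ S
    a₂∈             : a₂ ∈ˢ S
    a₃∈             : a₃ ∈ˢ S
    a₁≢1            : a₁ ≢ idP
    a₂-independent  : ∀ k → a₂ * (a₁ ^ₚ k) ≢ idP
    a₃-independent  : ∀ k l m → (a₃ * (a₁ ^ₚ k)) * ((a₂ * (a₁ ^ₚ l)) ^ₚ m) ≢ idP

module _ {n : ℕ} (S : Subgroup n) (cyclic-orbits : HasCyclicOrbits S) where

  open SubgroupProperties S

  adjust-to-fix : ∀ {e b i} → e ∈ˢ S → b ∈ˢ S → e Moves i → ∃[ k ] (b * (e ^ₚ k) Fixes i)
  adjust-to-fix {e} {b} {i} e∈ b∈ e-moves with k , eᵏi≡b⁻¹i ← cyclic-orbits e∈ (inv∈ b∈) e-moves =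
    k , trans (*-act b (e ^ₚ k) i) (trans (cong (b ·ₚ_) eᵏi≡b⁻¹i) (act-inv b∈ i))

  mover-fixing⇒transitive-fixing : ∀ {e j k i} → e ∈ˢ S → e Fixes j → e Fixes k → e Moves i →
    TransitiveFixing S j k i
  mover-fixing⇒transitive-fixing {e} e∈ fixes-j fixes-k e-moves a∈
    with l , eˡi≡ai ← cyclic-orbits e∈ a∈ e-moves =
    e ^ₚ l , ^ₚ-closed e∈ l , ^ₚ-fixes e fixes-j l , ^ₚ-fixes e fixes-k l , eˡi≡ai

  -- Gaussian elimination: b₁ and b₂ fix i₂, e₃ also fixes a point i₁ moved by b₁, and e₁ is
  -- b₁ corrected by e₃ so as to fix a point i₃ moved by e₃.
  independent-triple⇒general-position : IndependentTriple S → GeneralPosition S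
  independent-triple⇒general-position triple =
    let (i₂ , a₁-moves)     = moved-point a₁≢1
        (k , b₁-fixes-i₂)   = adjust-to-fix a₁∈ a₂∈ a₁-moves
        (l , b₂-fixes-i₂)   = adjust-to-fix a₁∈ a₃∈ a₁-moves
        b₁                  = a₂ * (a₁ ^ₚ k)
        b₂                  = a₃ * (a₁ ^ₚ l)
        b₁∈                 = mul-closed S a₂∈ (^ₚ-closed a₁∈ k)
        b₂∈                 = mul-closed S a₃∈ (^ₚ-closed a₁∈ l)
        (i₁ , b₁-moves)     = moved-point (a₂-independent k)
        (m , e₃-fixes-i₁)   = adjust-to-fix b₁∈ b₂∈ b₁-moves
        (i₃ , e₃-moves)     = moved-point (a₃-independent l k m)
        e₃                  = b₂ * (b₁ ^ₚ m)
        e₃∈                 = mul-closed S b₂∈ (^ₚ-closed b₁∈ m)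
        e₃-fixes-i₂         = *-fixes b₂ (b₁ ^ₚ m) b₂-fixes-i₂ (^ₚ-fixes b₁ b₁-fixes-i₂ m)
        (q , e₁-fixes-i₃)   = adjust-to-fix e₃∈ b₁∈ e₃-moves
    in record
      { transitive-i₁ = mover-fixing⇒transitive-fixing (mul-closed S b₁∈ (^ₚ-closed e₃∈ q))
          (*-fixes b₁ (e₃ ^ₚ q) b₁-fixes-i₂ (^ₚ-fixes e₃ e₃-fixes-i₂ q)) e₁-fixes-i₃
          (*-moves b₁ (e₃ ^ₚ q) b₁-moves (^ₚ-fixes e₃ e₃-fixes-i₁ q))
      ; transitive-i₃ = mover-fixing⇒transitive-fixing e₃∈ e₃-fixes-i₁ e₃-fixes-i₂ e₃-moves }
    where open IndependentTriple triple

-- Elementary abelian groups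

module _ (p : ℕ) .{{_ : ℕ.NonZero p}} where

  toℕ-mod : ∀ k → toℕ (k mod p) ≡ k % p
  toℕ-mod k = Finₚ.toℕ-fromℕ< (m%n<n k p)

  mod-cong : ∀ {k l} → k % p ≡ l % p → k mod p ≡ l mod p
  mod-cong {k} {l} eq = Finₚ.toℕ-injective (trans (toℕ-mod k) (trans eq (sym (toℕ-mod l))))

  mod-toℕ : (a : Fin p) → toℕ a mod p ≡ a
  mod-toℕ a = Finₚ.toℕ-injective (trans (toℕ-mod (toℕ a)) (m<n⇒m%n≡m (Finₚ.toℕ<n a)))

  mod-distrib-+ : ∀ k l → (k ℕ.+ l) mod p ≡ (toℕ (k mod p) ℕ.+ toℕ (l mod p)) mod p
  mod-distrib-+ k l = mod-cong (begin
    (k ℕ.+ l) % p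
      ≡⟨ %-distribˡ-+ k l p ⟩
    (k % p ℕ.+ l % p) % p
      ≡⟨ cong₂ (λ x y → (x ℕ.+ y) % p) (toℕ-mod k) (toℕ-mod l) ⟨
    (toℕ (k mod p) ℕ.+ toℕ (l mod p)) % p ∎)
    where open ≡-Reasoning

module ElementaryAbelian {n p : ℕ} (pr : Prime p) {m : ℕ} (S : Subgroup n)
  (iso : IsoToCpPower p pr m S) where

  open SubgroupProperties S

  private instance
    p-nonZero : ℕ.NonZero p
    p-nonZero = prime⇒nonZero pr

    p-nonTrivial : ℕ.NonTrivial p
    p-nonTrivial = prime⇒nonTrivial pr

  ι : Vec (Fin p) m → Perm n
  ι = proj₁ iso

  ι∈ : ∀ u → ι u ∈ˢ S
  ι∈ = proj₁ (proj₂ iso)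

  ι-surjective : ∀ {s} → s ∈ˢ S → ∃[ u ] (ι u ≡ s)
  ι-surjective = proj₁ (proj₂ (proj₂ iso))

  ι-injective : ∀ u v → ι u ≡ ι v → u ≡ v
  ι-injective = proj₁ (proj₂ (proj₂ (proj₂ iso)))

  ι-+ : ∀ u v → ι (_+ᶜ_ p u v) ≡ ι u * ι v
  ι-+ = proj₂ (proj₂ (proj₂ (proj₂ iso)))

  -- The composite ℕᵐ → (C_p)ᵐ → S; on ℕᵐ no reduction modulo p interferes with the algebra.
  ε : Vec ℕ m → Perm n
  ε v = ι (Vec.map (_mod p) v)

  ε∈ : ∀ v → ε v ∈ˢ S
  ε∈ v = ι∈ (Vec.map (_mod p) v)

  ε-surjective : ∀ {s} → s ∈ˢ S → ∃[ v ] (ε v ≡ s)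
  ε-surjective s∈ with u , ιu≡s ← ι-surjective s∈ =
    Vec.map toℕ u , trans (cong ι mods-toℕ) ιu≡s
    where
    mods-toℕ : Vec.map (_mod p) (Vec.map toℕ u) ≡ u
    mods-toℕ = trans (sym (Vecₚ.map-∘ (_mod p) toℕ u))
      (trans (Vecₚ.map-cong (mod-toℕ p) u) (Vecₚ.map-id u))

  ε-injective : ∀ {u v} → ε u ≡ ε v → Vec.map (_mod p) u ≡ Vec.map (_mod p) v
  ε-injective = ι-injective _ _

  ε-+ : ∀ u v → ε (zipWith ℕ._+_ u v) ≡ ε u * ε v
  ε-+ u v = trans (cong ι (mods-+ u v)) (ι-+ _ _)
    where
    mods-+ : ∀ {l} (u v : Vec ℕ l) →
      Vec.map (_mod p) (zipWith ℕ._+_ u v) ≡ _+ᶜ_ p (Vec.map (_mod p) u) (Vec.map (_mod p) v)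
    mods-+ []      []      = refl
    mods-+ (x ∷ u) (y ∷ v) = cong₂ _∷_ (mod-distrib-+ p x y) (mods-+ u v)

  𝟎 : ∀ {l} → Vec ℕ l
  𝟎 = replicate _ 0

  ε-𝟎 : ε 𝟎 ≡ idP
  ε-𝟎 = *-cancelˡ (ε∈ 𝟎) (begin
    ε 𝟎 * ε 𝟎                 ≡⟨ ε-+ 𝟎 𝟎 ⟨
    ε (zipWith ℕ._+_ 𝟎 𝟎)     ≡⟨ cong ε (zipWith-replicate ℕ._+_ 0 0) ⟩
    ε 𝟎                       ≡⟨ *-identityʳ (ε 𝟎) ⟨
    ε 𝟎 * idP                 ∎)
    where open ≡-Reasoning

  ε-· : ∀ k v → ε (Vec.map (k ℕ.*_) v) ≡ ε v ^ₚ k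
  ε-· zero    v = trans (cong ε (map-const v 0)) ε-𝟎
  ε-· (suc k) v = begin
    ε (Vec.map (suc k ℕ.*_) v)                    ≡⟨ cong ε (map-suc-* v) ⟩
    ε (zipWith ℕ._+_ v (Vec.map (k ℕ.*_) v))      ≡⟨ ε-+ v _ ⟩
    ε v * ε (Vec.map (k ℕ.*_) v)                  ≡⟨ cong (ε v *_) (ε-· k v) ⟩
    ε v ^ₚ suc k                                  ∎
    where
    open ≡-Reasoning
    map-suc-* : ∀ {l} (v : Vec ℕ l) → Vec.map (suc k ℕ.*_) v ≡ zipWith ℕ._+_ v (Vec.map (k ℕ.*_) v)
    map-suc-* []      = refl
    map-suc-* (x ∷ v) = cong (_ ∷_) (map-suc-* v)

  abelian : IsAbelian S
  abelian a∈ b∈ with u , refl ← ε-surjective a∈ with v , refl ← ε-surjective b∈ = begin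
    ε u * ε v                 ≡⟨ ε-+ u v ⟨
    ε (zipWith ℕ._+_ u v)     ≡⟨ cong ε (zipWith-comm ℕₚ.+-comm u v) ⟩
    ε (zipWith ℕ._+_ v u)     ≡⟨ ε-+ v u ⟩
    ε v * ε u                 ∎
    where open ≡-Reasoning

  exponent : HasExponent S p
  exponent s∈ with v , refl ← ε-surjective s∈ = begin
    ε v ^ₚ p                  ≡⟨ ε-· p v ⟨
    ε (Vec.map (p ℕ.*_) v)    ≡⟨ cong ι (mods-p* v) ⟩
    ε 𝟎                       ≡⟨ ε-𝟎 ⟩
    idP                       ∎
    where
    open ≡-Reasoning
    mods-p* : ∀ {l} (v : Vec ℕ l) → Vec.map (_mod p) (Vec.map (p ℕ.*_) v) ≡ Vec.map (_mod p) 𝟎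
    mods-p* []      = refl
    mods-p* (x ∷ v) = cong₂ _∷_
      (mod-cong p (trans (cong (_% p) (ℕₚ.*-comm p x)) (trans (m*n%n≡0 x p) (sym (m*n%n≡0 0 p)))))
      (mods-p* v)

  HasCoordinate : Fin m → ℕ → Perm n → Set
  HasCoordinate j x s = ∃[ v ] (ε v ≡ s × lookup v j ≡ x)

  coordinate-* : ∀ {j x s t} → HasCoordinate j x s → HasCoordinate j 0 t → HasCoordinate j x (s * t)
  coordinate-* {j} (u , refl , refl) (v , refl , vⱼ≡0) = zipWith ℕ._+_ u v , ε-+ u v , (begin
    lookup (zipWith ℕ._+_ u v) j    ≡⟨ lookup-zipWith ℕ._+_ j u v ⟩
    lookup u j ℕ.+ lookup v j       ≡⟨ cong (lookup u j ℕ.+_) vⱼ≡0 ⟩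
    lookup u j ℕ.+ 0                ≡⟨ ℕₚ.+-identityʳ _ ⟩
    lookup u j                      ∎)
    where open ≡-Reasoning

  coordinate-^ₚ : ∀ {j s} → HasCoordinate j 0 s → ∀ k → HasCoordinate j 0 (s ^ₚ k)
  coordinate-^ₚ {j} sⱼ≡0 zero    = 𝟎 , ε-𝟎 , lookup-replicate j 0
  coordinate-^ₚ     sⱼ≡0 (suc k) = coordinate-* sⱼ≡0 (coordinate-^ₚ sⱼ≡0 k)

  coordinate-1⇒≢idP : ∀ {j s} → HasCoordinate j 1 s → s ≢ idP
  coordinate-1⇒≢idP {j} (v , refl , vⱼ≡1) εv≡1 = contradiction 1≡0 λ ()
    where
    open ≡-Reasoning
    1≡0 : 1 ≡ 0
    1≡0 = begin
      1                                     ≡⟨ m<n⇒m%n≡m (ℕ.nonTrivial⇒n>1 p) ⟨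
      1 % p                                 ≡⟨ toℕ-mod p 1 ⟨
      toℕ (1 mod p)                         ≡⟨ cong (λ x → toℕ (x mod p)) vⱼ≡1 ⟨
      toℕ (lookup v j mod p)                ≡⟨ cong toℕ (lookup-map j (_mod p) v) ⟨
      toℕ (lookup (Vec.map (_mod p) v) j)   ≡⟨ cong (λ u → toℕ (lookup u j))
                                                 (ε-injective (trans εv≡1 (sym ε-𝟎))) ⟩
      toℕ (lookup (Vec.map (_mod p) 𝟎) j)   ≡⟨ cong toℕ (lookup-map j (_mod p) 𝟎) ⟩
      toℕ (lookup 𝟎 j mod p)                ≡⟨ cong (λ x → toℕ (x mod p)) (lookup-replicate j 0) ⟩
      toℕ (0 mod p)                         ≡⟨ toℕ-mod p 0 ⟩
      0 % p                                 ≡⟨ m*n%n≡0 0 p ⟩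
      0                                     ∎

IsCyclic : ∀ {n} → Subgroup n → Set
IsCyclic S = ∃[ g ] (g ∈ˢ S × (∀ {s} → s ∈ˢ S → ∃[ k ] (s ≡ g ^ₚ k)))

rank≤1⇒cyclic : ∀ {n p m} (pr : Prime p) (S : Subgroup n) → IsoToCpPower p pr m S → m ℕ.≤ 1 →
  IsCyclic S
rank≤1⇒cyclic {m = zero} pr S iso _ = idP , has-id S , generates
  where
  open ElementaryAbelian pr S iso
  generates : ∀ {s} → s ∈ˢ S → ∃[ k ] (s ≡ idP ^ₚ k)
  generates s∈ with [] , refl ← ε-surjective s∈ = 0 , ε-𝟎
rank≤1⇒cyclic {m = suc zero} pr S iso _ = ε (1 ∷ []) , ε∈ _ , generates
  where
  open ElementaryAbelian pr S iso
  generates : ∀ {s} → s ∈ˢ S → ∃[ k ] (s ≡ ε (1 ∷ []) ^ₚ k)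
  generates s∈ with k ∷ [] , refl ← ε-surjective s∈ =
    k , trans (cong (λ x → ε (x ∷ [])) (sym (ℕₚ.*-identityʳ k))) (ε-· k (1 ∷ []))
rank≤1⇒cyclic {m = suc (suc _)} _ _ _ (ℕ.s≤s ())

rank≥3⇒independent-triple : ∀ {n p m} (pr : Prime p) (S : Subgroup n) →
  IsoToCpPower p pr (3 ℕ.+ m) S → IndependentTriple S
rank≥3⇒independent-triple pr S iso = record
  { a₁∈            = ε∈ v₁
  ; a₂∈            = ε∈ v₂
  ; a₃∈            = ε∈ v₃
  ; a₁≢1           = coordinate-1⇒≢idP {fzero} (v₁ , refl , refl)
  ; a₂-independent = λ k → coordinate-1⇒≢idP {fsuc fzero}
      (coordinate-* (v₂ , refl , refl) (coordinate-^ₚ (v₁ , refl , refl) k))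
  ; a₃-independent = λ k l q → coordinate-1⇒≢idP {fsuc (fsuc fzero)}
      (coordinate-* (coordinate-* (v₃ , refl , refl) (coordinate-^ₚ (v₁ , refl , refl) k))
        (coordinate-^ₚ (coordinate-* (v₂ , refl , refl) (coordinate-^ₚ (v₁ , refl , refl) l)) q)) }
  where
  open ElementaryAbelian pr S iso
  v₁ v₂ v₃ : Vec ℕ _
  v₁ = 1 ∷ 0 ∷ 0 ∷ 𝟎
  v₂ = 0 ∷ 1 ∷ 0 ∷ 𝟎
  v₃ = 0 ∷ 0 ∷ 1 ∷ 𝟎

-- Ind and J as functions on points

module Evaluation {n : ℕ} (G H : Subgroup n) (transitive : IsTransitive G)
  (i₀ : Fin n) (stabilizer : IsPointStabilizer G H i₀) where

  open SubgroupProperties G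

  γ : Fin n → Perm n
  γ j = proj₁ (transitive j i₀)

  γ∈ : ∀ j → γ j ∈ˢ G
  γ∈ j = proj₁ (proj₂ (transitive j i₀))

  γ-act : ∀ j → γ j ·ₚ j ≡ i₀
  γ-act j = proj₂ (proj₂ (transitive j i₀))

  eval : Cochain n → Fin n → ℤ
  eval x j = x (γ j)

  eval-unique : ∀ {x z j} → IsInd G H x → z ∈ˢ G → z ·ₚ j ≡ i₀ → x z ≡ eval x j
  eval-unique {x} {z} {j} x-ind z∈ zj≡i₀ =
    trans (cong x (sym (inv-*-cancelʳ (γ∈ j) z))) (x-ind h∈ (γ∈ j))
    where
    γ⁻¹ : Perm n
    γ⁻¹ = inv (γ∈ j)
    h-fixes : z * γ⁻¹ Fixes i₀
    h-fixes = begin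
      (z * γ⁻¹) ·ₚ i₀          ≡⟨ *-act z γ⁻¹ i₀ ⟩
      z ·ₚ (γ⁻¹ ·ₚ i₀)         ≡⟨ cong (λ k → z ·ₚ (γ⁻¹ ·ₚ k)) (γ-act j) ⟨
      z ·ₚ (γ⁻¹ ·ₚ (γ j ·ₚ j)) ≡⟨ cong (z ·ₚ_) (inv-act (γ∈ j) j) ⟩
      z ·ₚ j                   ≡⟨ zj≡i₀ ⟩
      i₀                       ∎
      where open ≡-Reasoning
    h∈ : (z * γ⁻¹) ∈ˢ H
    h∈ = Equivalence.from (stabilizer _) (mul-closed G z∈ (inv∈ (γ∈ j)) , h-fixes)

  -- Twisting by the group elements turns the left action of G on J into the action ◃
  -- from the right, so that no inverses occur.
  pt¹ : (Perm n → Cochain n) → C¹ n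
  pt¹ φ a i = eval (φ a) (a ·ₚ i)

  pt² : Cochain2 n → C² n
  pt² f a b i = eval (f a b) ((a * b) ·ₚ i)

  ≈J⇒≃ : ∀ {x y : Cochain n} (j : Fin n → Fin n) → x ≈J[ G ] y →
    (λ i → eval x (j i)) ≃ (λ i → eval y (j i)) [mod 0ℤ ]
  ≈J⇒≃ {x} {y} j (c , x≡y+c) = ≃-by (≃-constant {c = c} {0ℤ}) λ i →
    trans (regroup (eval y (j i)) c) (cong (_- eval y (j i)) (sym (x≡y+c (γ∈ (j i)))))
    where
    regroup : ∀ y c → c - 0ℤ ≡ y + c - y
    regroup = solve-∀

  γ*-act : ∀ a k → (γ (a ·ₚ k) * a) ·ₚ k ≡ i₀
  γ*-act a k = trans (*-act (γ (a ·ₚ k)) a k) (γ-act (a ·ₚ k))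

  eval-act : ∀ {x a} → IsInd G H x → a ∈ˢ G → ∀ k → eval (act a x) (a ·ₚ k) ≡ eval x k
  eval-act {x} {a} x-ind a∈ k = eval-unique x-ind (mul-closed G (γ∈ (a ·ₚ k)) a∈) (γ*-act a k)

  pt²-cocycle : ∀ {f} → Is2Cocycle G H f → Z² 0ℤ G (pt² f)
  pt²-cocycle {f} (f-ind , f-cocycle) {a} {b} {c} a∈ b∈ c∈ =
    ≃-by (≃-sym (≈J⇒≃ {y = zeroJ} point (f-cocycle a∈ b∈ c∈))) λ i → begin
      0ℤ - (eval (act a (f b c)) (point i) - eval (f (a * b) c) (point i)
              + eval (f a (b * c)) (point i) - eval (f a b) (point i))
        ≡⟨ cong (λ x → 0ℤ - (x - eval (f (a * b) c) (point i)
               + eval (f a (b * c)) (point i) - eval (f a b) (point i)))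
             (trans (cong (eval (act a (f b c))) (*-act a (b * c) i))
               (eval-act (f-ind b∈ c∈) a∈ ((b * c) ·ₚ i))) ⟩
      0ℤ - (pt² f b c i - eval (f (a * b) c) (point i)
              + pt² f a (b * c) i - eval (f a b) (point i))
        ≡⟨ cong₂ (λ j k → 0ℤ - (pt² f b c i - eval (f (a * b) c) j
               + pt² f a (b * c) i - eval (f a b) k))
             (point-assoc i) (trans (point-assoc i) (*-act (a * b) c i)) ⟩
      0ℤ - (pt² f b c i - pt² f (a * b) c i + pt² f a (b * c) i - pt² f a b (c ·ₚ i))
        ≡⟨ regroup (pt² f b c i) (pt² f (a * b) c i) (pt² f a (b * c) i) (pt² f a b (c ·ₚ i)) ⟩
      pt² f a b (c ·ₚ i) + pt² f (a * b) c i - (pt² f a (b * c) i + pt² f b c i) ∎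
    where
    open ≡-Reasoning
    point : Fin n → Fin n
    point i = (a * (b * c)) ·ₚ i
    point-assoc : ∀ i → point i ≡ ((a * b) * c) ·ₚ i
    point-assoc i = cong (_·ₚ i) (sym (*-assoc a b c))
    regroup : ∀ x y z w → 0ℤ - (x - y + z - w) ≡ w + y - (z + x)
    regroup = solve-∀

  pt²-coboundary⁺ : ∀ {K f} → K ≤ˢ G → IsCoboundaryOn G H K f → B² 0ℤ K (pt² f)
  pt²-coboundary⁺ {K} {f} K≤G (φ , φ-ind , φ-bounds) = pt¹ φ , λ {a} {b} a∈ b∈ →
    ≃-by (≈J⇒≃ {y = (act a (φ b) ⊖ φ (a * b)) ⊕ φ a} (λ i → (a * b) ·ₚ i) (φ-bounds a∈ b∈)) λ i →
      cong₂ (λ x y → pt² f a b i - (x - pt¹ φ (a * b) i + y))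
        (trans (cong (eval (act a (φ b))) (*-act a b i)) (eval-act (φ-ind b∈) (K≤G a∈) (b ·ₚ i)))
        (cong (eval (φ a)) (*-act a b i))

  preimages : Σ[ π ∈ (Perm n → Fin n) ] (∀ {y} → y ∈ˢ G → y ·ₚ π y ≡ i₀)
  preimages = choice _≟ₚ_ i₀ {P = λ y j → y ·ₚ j ≡ i₀} λ y∈ → inv y∈ ·ₚ i₀ , act-inv y∈ i₀

  π : Perm n → Fin n
  π = proj₁ preimages

  π-act : ∀ {y} → y ∈ˢ G → y ·ₚ π y ≡ i₀
  π-act = proj₂ preimages

  π-unique : ∀ {y j} → y ∈ˢ G → y ·ₚ j ≡ i₀ → π y ≡ j
  π-unique {y} {j} y∈ yj≡i₀ = perms G y∈ (π y) j (trans (π-act y∈) (sym yj≡i₀))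

  module _ (Φ : C¹ n) where

    pt⁻¹ : Perm n → Cochain n
    pt⁻¹ a z = Φ a (π (z * a))

    pt⁻¹-ind : ∀ {a} → a ∈ˢ G → IsInd G H (pt⁻¹ a)
    pt⁻¹-ind {a} a∈ {h} {z} h∈ z∈ =
      cong (Φ a) (π-unique (mul-closed G (mul-closed G h∈G z∈) a∈) (begin
        ((h * z) * a) ·ₚ π (z * a)     ≡⟨ cong (_·ₚ π (z * a)) (*-assoc h z a) ⟩
        (h * (z * a)) ·ₚ π (z * a)     ≡⟨ *-act h (z * a) (π (z * a)) ⟩
        h ·ₚ ((z * a) ·ₚ π (z * a))    ≡⟨ cong (h ·ₚ_) (π-act (mul-closed G z∈ a∈)) ⟩
        h ·ₚ i₀                        ≡⟨ proj₂ (Equivalence.to (stabilizer h) h∈) ⟩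
        i₀                             ∎))
      where
      open ≡-Reasoning
      h∈G : h ∈ˢ G
      h∈G = proj₁ (Equivalence.to (stabilizer h) h∈)

    δ-pt⁻¹ : ∀ {a b z} → a ∈ˢ G → b ∈ˢ G → z ∈ˢ G →
      ((act a (pt⁻¹ b) ⊖ pt⁻¹ (a * b)) ⊕ pt⁻¹ a) z ≡ δ Φ a b (π (z * (a * b)))
    δ-pt⁻¹ {a} {b} {z} a∈ b∈ z∈ = cong₂ (λ k l → Φ b k - Φ (a * b) j + Φ a l)
      (cong π (*-assoc z a b)) (π-unique (mul-closed G z∈ a∈) (begin
        (z * a) ·ₚ (b ·ₚ j)     ≡⟨ *-act (z * a) b j ⟨
        ((z * a) * b) ·ₚ j      ≡⟨ cong (_·ₚ j) (*-assoc z a b) ⟩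
        (z * (a * b)) ·ₚ j      ≡⟨ π-act (mul-closed G z∈ (mul-closed G a∈ b∈)) ⟩
        i₀                      ∎))
      where
      open ≡-Reasoning
      j : Fin n
      j = π (z * (a * b))

  pt²-coboundary⁻ : ∀ {f} → (∀ {a b} → a ∈ˢ G → b ∈ˢ G → IsInd G H (f a b)) →
    B² 0ℤ G (pt² f) → IsCoboundaryOn G H G f
  pt²-coboundary⁻ {f} f-ind (Φ , Φ-bounds) =
    pt⁻¹ Φ , pt⁻¹-ind Φ , λ {a} {b} a∈ b∈ → pt² f a b i₀ - δ Φ a b i₀ , f≡δpt⁻¹ a∈ b∈
    where
    f≡δpt⁻¹ : ∀ {a b z} → a ∈ˢ G → b ∈ˢ G → z ∈ˢ G →
      f a b z ≡ ((act a (pt⁻¹ Φ b) ⊖ pt⁻¹ Φ (a * b)) ⊕ pt⁻¹ Φ a) z + (pt² f a b i₀ - δ Φ a b i₀)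
    f≡δpt⁻¹ {a} {b} {z} a∈ b∈ z∈ = begin
      f a b z
        ≡⟨ eval-unique (f-ind a∈ b∈) z∈
             (trans (sym (*-act z (a * b) j)) (π-act (mul-closed G z∈ (mul-closed G a∈ b∈)))) ⟩
      pt² f a b j
        ≡⟨ regroup (pt² f a b j) (pt² f a b i₀) ⟩
      pt² f a b j - pt² f a b i₀ + pt² f a b i₀
        ≡⟨ cong (_+ pt² f a b i₀) (≈-mod-0⇒≡ (differences (Φ-bounds a∈ b∈) j i₀)) ⟩
      δ Φ a b j - δ Φ a b i₀ + pt² f a b i₀
        ≡⟨ reassociate (δ Φ a b j) (δ Φ a b i₀) (pt² f a b i₀) ⟩
      δ Φ a b j + (pt² f a b i₀ - δ Φ a b i₀)
        ≡⟨ cong (_+ (pt² f a b i₀ - δ Φ a b i₀)) (δ-pt⁻¹ Φ a∈ b∈ z∈) ⟨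
      ((act a (pt⁻¹ Φ b) ⊖ pt⁻¹ Φ (a * b)) ⊕ pt⁻¹ Φ a) z + (pt² f a b i₀ - δ Φ a b i₀) ∎
      where
      open ≡-Reasoning
      j : Fin n
      j = π (z * (a * b))
      regroup : ∀ x y → x ≡ x - y + y
      regroup = solve-∀
      reassociate : ∀ x y z → x - y + z ≡ x + (z - y)
      reassociate = solve-∀

-- Triviality on the Sylow subgroup and transfer

LocallyTrivial : ∀ {n} → Subgroup n → C² n → Set
LocallyTrivial {n} S F = ∀ {g} → g ∈ˢ S → ∃[ D ] (IsCyclicGenBy {n} D g × B² 0ℤ D F)

B²-antitone : ∀ {n} {K L : Subgroup n} {F : C² n} → K ≤ˢ L → B² N L F → B² N K F
B²-antitone K≤L (Φ , Φ-bounds) = Φ , λ a∈ b∈ → Φ-bounds (K≤L a∈) (K≤L b∈)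

module _ {n : ℕ} (S : Subgroup n) {F : C² n} (locally-trivial : LocallyTrivial S F) where

  open SubgroupProperties S

  cyclic⇒∈B² : IsCyclic S → B² 0ℤ S F
  cyclic⇒∈B² (g , g∈ , generates) with D , D≡⟨g⟩ , F-trivial ← locally-trivial g∈ =
    B²-antitone {K = S} {L = D} (λ s∈ → Equivalence.from (D≡⟨g⟩ _) (generates s∈)) F-trivial

  locally-trivial⇒fixed-points-agree : ∀ {m} .{{_ : ℕ.NonZero m}} → HasExponent S m →
    {V : C¹ n} → Cobounds 0ℤ S V (N ⊙² F) → FixedPointsAgree N S V
  locally-trivial⇒fixed-points-agree {m = m} exponent {V} V-bounds {a} a∈ =
    let (D , D≡⟨a⟩ , F-trivial) = locally-trivial a∈
        D≤S : D ≤ˢ S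
        D≤S x∈ = let (k , x≡aᵏ) = Equivalence.to (D≡⟨a⟩ _) x∈ in
          subst (_∈ˢ S) (sym x≡aᵏ) (^ₚ-closed a∈ k)
    in ∈B²⇒fixed-points-agree D {F = F} {V} (λ b∈ c∈ → V-bounds (D≤S b∈) (D≤S c∈)) F-trivial m
      (Equivalence.from (D≡⟨a⟩ a) (1 , sym (*-identityʳ a))) (exponent a∈)

  general-position⇒∈B² : ∀ {m} .{{_ : ℕ.NonZero m}} → IsAbelian S → HasExponent S m →
    HasCyclicOrbits S → GeneralPosition S → Z² 0ℤ S F → B² 0ℤ S F
  general-position⇒∈B² abelian exponent cyclic-orbits position F-cocycle =
    let (r , r≢0 , V , V-bounds) = nonzero-multiple∈B² S F-cocycle
        V-cocycle : Z¹ r S V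
        V-cocycle = cobounds-multiple⇒Z¹ {K = S} {F = F} {V} V-bounds
        agree : FixedPointsAgree r S V
        agree = locally-trivial⇒fixed-points-agree exponent {V} V-bounds
    in bockstein {K = S} {{r≢0}} (GeneralPosition.i₁ position) {F} {V} V-bounds
         (CentralExtension.general-position⇒∈B¹ S abelian {V = V} V-cocycle agree
           cyclic-orbits position)

elementary-abelian⇒∈B² : ∀ {n p m} (pr : Prime p) (S : Subgroup n) {F : C² n} → m ≢ 2 →
  IsoToCpPower p pr m S → HasCyclicOrbits S → LocallyTrivial S F → Z² 0ℤ S F → B² 0ℤ S F
elementary-abelian⇒∈B² {m = 0} pr S _ iso _ F-local _ =
  cyclic⇒∈B² S F-local (rank≤1⇒cyclic pr S iso ℕ.z≤n)
elementary-abelian⇒∈B² {m = 1} pr S _ iso _ F-local _ =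
  cyclic⇒∈B² S F-local (rank≤1⇒cyclic pr S iso ℕₚ.≤-refl)
elementary-abelian⇒∈B² {m = 2} _ _ 2≢2 = contradiction refl 2≢2
elementary-abelian⇒∈B² {m = suc (suc (suc _))} pr S _ iso cyclic-orbits F-local =
  general-position⇒∈B² S F-local {{prime⇒nonZero pr}} abelian exponent cyclic-orbits
    (independent-triple⇒general-position S cyclic-orbits (rank≥3⇒independent-triple pr S iso))
  where open ElementaryAbelian pr S iso

sylow⇒∤index : ∀ {n p} (G S : Subgroup n) (sylow : IsSylow p G S) →
  ¬ (p ∣ Cosets.index S G (proj₁ sylow))
sylow⇒∤index {p = p} G S (S≤G , v , r , _ , |G|≡|S|r , p∤r) =
  subst (λ t → ¬ (p ∣ t)) (sym index≡r) p∤r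
  where
  open Cosets S G S≤G
  index≡r : index ≡ r
  index≡r = ℕₚ.*-cancelˡ-≡ index r (order S)
    {{ℕ.>-nonZero (∈-length (has-id S))}} (trans order-*-index |G|≡|S|r)

sylow-restriction-injective : ∀ {n p} → Prime p → (G S : Subgroup n) → IsSylow p G S →
  {F : C² n} → Z² N G F → ∀ k → B² N G (ℤ.+ (p ^ k) ⊙² F) → B² N S F → B² N G F
sylow-restriction-injective pr G S sylow F-cocycle k torsion F-trivial-on-S =
  coprime-multiples∈B²⇒∈B² {K = G} (coprime-^ (∤⇒coprime pr (sylow⇒∤index G S sylow)) k)
    (Transfer.transfer S G (proj₁ sylow) F-cocycle F-trivial-on-S) torsion

theorem6p10 :
    (p : ℕ) (pr : Prime p) (n : ℕ) →
    p ∣ n → ¬ (p ^ 2 ∣ n) →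
    (G H : Subgroup n) → IsTransitive G →
    (i₀ : Fin n) → IsPointStabilizer G H i₀ →
    (S : Subgroup n) → IsSylow p G S → IsNormal G S →
    (m : ℕ) → m ≢ 2 → IsoToCpPower p pr m S →
    (𝒟 : List (Subgroup n)) → IsAdmissible G 𝒟 →
    (f : Cochain2 n) → Is2Cocycle G H f →
    (∀ {D} → D ∈ 𝒟 → IsCoboundaryOn G H D f) →
    (∃[ k ] IsCoboundaryOn G H G (scale2 (p ^ k) f)) →
    IsCoboundaryOn G H G f
theorem6p10 p pr n _ p²∤n G H transitive i₀ stabilizer S sylow@(S≤G , v , _ , |S|≡pᵛ , _) normal
  m m≢2 iso 𝒟 (𝒟≤G , cyclic∈𝒟 , _) f f-cocycle f-local (k , f-torsion) =
  pt²-coboundary⁻ (proj₁ f-cocycle)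
    (sylow-restriction-injective pr G S sylow F-cocycle k
      (pt²-coboundary⁺ {G} id f-torsion) F-trivial-on-S)
  where
  open Evaluation G H transitive i₀ stabilizer
  F-cocycle : Z² 0ℤ G (pt² f)
  F-cocycle = pt²-cocycle f-cocycle
  F-local : LocallyTrivial S (pt² f)
  F-local g∈ with D , D∈𝒟 , D≡⟨g⟩ ← find (cyclic∈𝒟 (S≤G g∈)) =
    D , D≡⟨g⟩ , pt²-coboundary⁺ {D} (𝒟≤G D∈𝒟) (f-local D∈𝒟)
  cyclic-orbits : HasCyclicOrbits S
  cyclic-orbits = normal-p-subgroup⇒cyclic-orbits {v = v} pr p²∤n G S normal transitive |S|≡pᵛ
    (ElementaryAbelian.exponent pr S iso)
  F-trivial-on-S : B² 0ℤ S (pt² f)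
  F-trivial-on-S = elementary-abelian⇒∈B² pr S m≢2 iso cyclic-orbits F-local
    λ a∈ b∈ c∈ → F-cocycle (S≤G a∈) (S≤G b∈) (S≤G c∈)
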